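{- If a subset $A\subseteq\omega^\omega$ is recursive over $\omega^\omega$, then $A$ is $\Delta^0_2$ over $\omega^\omega$.
   Context: Write $\mathbb{N}=\omega=\{0,1,2,\dots\}$, $\mathcal{N}=\omega^\omega$ (Baire space), and $0_{\mathcal{N}}$ for the constant zero sequence. All functions may be partial. Universal TTE-computable functions. Fix standard effective enumerations of oracle Turing machines with $q$ oracles from $\mathcal{N}$ ($q\ge 0$). $\Phi^{\vec x}(e,i)$ is the result of the $e$-th machine on input $i$ with oracles $\vec x=(x_1,\dots,x_q)$, and $\Psi_q(e;\vec x)=\Phi^{\vec x}(e)$ is the sequence $y\in\mathcal{N}$ with $y(i)=\Phi^{\vec x}(e,i)$; it is defined iff $\Phi^{\vec x}(e,i)$ is defined for all $i$. Partial recursive functions over $\mathcal{N}$. This is the smallest class of partial functions from $\mathbb{N}^p\times\mathcal{N}^q$ ($p+q\ge1$) to $\mathbb{N}$ or $\mathcal{N}$ that contains: the zero function $\mathbb{N}\to\mathbb{N}$, the successor function $\mathbb{N}\to\mathbb{N}$, all projections $(n_1,\dots,n_p;x_1,\dots,x_q)\mapsto n_i$ or $x_j$, the universal functions $\Psi_q$, and $\chi:\mathcal{N}\to\mathbb{N}$ with $\chi(0_{\mathcal{N}})=1$ and $\chi(x)=0$ for $x\ne0_{\mathcal{N}}$; and that is closed under: composition $f(g_1(\vec m;\vec y),\dots,g_p(\vec m;\vec y);h_1(\vec m;\vec y),\dots,h_q(\vec m;\vec y))$ (with $g_i$ having codomain $\mathbb{N}$ and $h_j$ codomain $\mathcal{N}$;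 the value is defined only if all inner values are); primitive recursion on a numerical variable, $F(0,\vec n;\vec x)=G(\vec n;\vec x)$, $F(k+1,\vec n;\vec x)=H(k,\vec n;\vec x,F(k,\vec n;\vec x))$ for codomain $\mathcal{N}$, and analogously $F(k+1,\vec n;\vec x)=H(k,\vec n,F(k,\vec n;\vec x);\vec x)$ for codomain $\mathbb{N}$; and the $\mu$-operator on $\mathbb{N}$: from $G:\mathbb{N}^{p+1}\times\mathcal{N}^q\to\mathbb{N}$ one obtains $F(\vec n;\vec x)=$ the least $k$ such that $G(k,\vec n;\vec x)=0$ and $G(k',\vec n;\vec x)$ is defined and nonzero for all $k'<k$ (undefined if there is no such $k$). A subset $A\subseteq\mathcal{N}$ is recursive over $\mathcal{N}$ if its (total) characteristic function $\chi_A:\mathcal{N}\to\mathbb{N}$ is partial recursive over $\mathcal{N}$. For $\sigma\in\omega^{<\omega}$ let $[\![\sigma]\!]=\{f\in\mathcal{N}:\sigma\prec f\}$. A set $A\subseteq\mathcal{N}$ is $\Pi^0_2$ (effectively $G_\delta$) if there is a recursive double sequence $\langle\sigma_{i,j}\rangle$ in $\omega^{<\omega}$ with $A=\bigcap_i\bigcup_j[\![\sigma_{i,j}]\!]$; it is $\Sigma^0_2$ (effectively $F_\sigma$) if its complement is $\Pi^0_2$; it is $\Delta^0_2$ over $\mathcal{N}$ if it is both. -}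

module Defs where

open import Data.Bool.Base using (Bool; true; false; if_then_else_)
open import Data.Bool.Properties using () renaming (_≟_ to _≟ᵇ_)
open import Data.Fin.Base using (Fin; zero; suc; toℕ)
open import Data.List.Base as List
  using (List; []; _∷_; _++_; length; replicate; takeWhileᵇ; dropWhileᵇ)
open import Data.Maybe.Base using (Maybe; just; nothing)
open import Data.Nat.Base using (ℕ; zero; suc; _+_; _*_; _^_; _<_; NonZero)
open import Data.Nat.DivMod using (_mod_)
open import Data.Nat.Properties using (_≟_)
open import Data.Product.Base using (Σ-syntax; ∃-syntax; _×_; _,_)
open import Data.Sum.Base using (_⊎_)
open import Data.Vec.Base as Vec using (Vec; []; _∷_; _∷ʳ_)
open import Data.Vec.Relation.Binary.Pointwise.Inductive using (Pointwise)
open import Function.Base using (id)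
open import Level using (Level)
open import Relation.Binary.PropositionalEquality using (_≡_; _≢_)
open import Relation.Nullary.Decidable.Core using (does; _×-dec_)
open import Relation.Unary using (Pred; _∈_; _∉_; ∁; _≐_; ⋂; ⋃)

private variable
  ℓ : Level
  m n p p′ q q′ : ℕ

-- Functions are compared pointwise only.  Subsets of 𝒩 are arbitrary
-- predicates: those that are recursive over 𝒩 automatically respect
-- pointwise equality.
𝒩 : Set
𝒩 = ℕ → ℕ

------------------------------------------------------------------------
-- Coding of finite sequences

-- The bijection ω^{<ω} → ω sending (a₀,…,aₖ) to the number whose binary
-- digits 1 are at the places a₀, a₀+a₁+1, a₀+a₁+a₂+2, ….
encode : List ℕ → ℕ
encode []      = 0
encode (a ∷ σ) = 2 ^ a * suc (2 * encode σ)

-- Binary increment: encode (next σ) ≡ suc (encode σ).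
next : List ℕ → List ℕ
next []          = 0 ∷ []
next (suc a ∷ σ) = 0 ∷ a ∷ σ
next (zero  ∷ σ) = carry (next σ)
  where
  carry : List ℕ → List ℕ
  carry []      = []   -- never reached
  carry (a ∷ τ) = suc a ∷ τ

-- The inverse of encode.
decode : ℕ → List ℕ
decode zero    = []
decode (suc n) = next (decode n)

------------------------------------------------------------------------
-- Oracle Turing machines

-- One two-way infinite tape with symbols false (blank) and true (stroke).
data Action (q : ℕ) : Set where
  print      : Bool → Action q
  left right : Action q
  query      : Fin q → Action q

record Quadruple (q : ℕ) : Set where
  constructor quad
  field
    state  : ℕ
    symbol : Bool
    action : Action q
    state′ : ℕ

-- The first applicable quadruple is executed; the machine halts when
-- there is none.  The initial state is 0.
Machine : ℕ → Set
Machine q = List (Quadruple q)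

-- The head scans the first cell of `rightward`; `leftward` lists the cells
-- left of the head, nearest first.  Cells that are not listed are blank.
record Config : Set where
  constructor config
  field
    state     : ℕ
    leftward  : List Bool
    rightward : List Bool

scan : List Bool → Bool
scan []      = false
scan (b ∷ _) = b

beyond : List Bool → List Bool
beyond []      = []
beyond (_ ∷ r) = r

-- Numbers are read and written in unary: the length of the maximal block of
-- strokes that starts at the head and extends to the right.
block : List Bool → ℕ
block r = length (takeWhileᵇ id r)

-- `query j` replaces the block at the head, of length n, by a block of
-- length xⱼ(n).
perform : Vec 𝒩 q → Action q → ℕ → List Bool → List Bool → Config
perform xs (print b) s l r = config s l (b ∷ beyond r)
perform xs left      s l r = config s (beyond l) (scan l ∷ r)
perform xs right     s l r = config s (scan r ∷ l) (beyond r)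
perform xs (query j) s l r =
  config s l (replicate (Vec.lookup xs j (block r)) true ++ dropWhileᵇ id r)

step : Machine q → Vec 𝒩 q → Config → Maybe Config
step []                   xs c              = nothing
step (quad s b a s′ ∷ M) xs c@(config t l r) =
  if does ((s ≟ t) ×-dec (b ≟ᵇ scan r))
  then just (perform xs a s′ l r)
  else step M xs c

data Result (M : Machine q) (xs : Vec 𝒩 q) : Config → ℕ → Set where
  halt : ∀ {c} → step M xs c ≡ nothing → Result M xs c (block (Config.rightward c))
  move : ∀ {c c′ k} → step M xs c ≡ just c′ → Result M xs c′ k → Result M xs c k

initial : ℕ → Config
initial i = config 0 [] (replicate i true)

toSymbol : ℕ → Bool
toSymbol zero    = false
toSymbol (suc _) = true

toAction : Fin (4 + q) → Action q
toAction zero                      = print false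
toAction (suc zero)                = print true
toAction (suc (suc zero))          = left
toAction (suc (suc (suc zero)))    = right
toAction (suc (suc (suc (suc j)))) = query j

toMachine : List ℕ → Machine q
toMachine {q} (s ∷ b ∷ a ∷ s′ ∷ σ) =
  quad s (toSymbol b) (toAction (a mod (4 + q))) s′ ∷ toMachine σ
toMachine _ = []

-- Effective enumeration of all machines with q oracles.
machine : ∀ q → ℕ → Machine q
machine q e = toMachine (decode e)

-- Φ xs e i k : the e-th machine with oracles xs has result k on input i.
Φ : Vec 𝒩 q → ℕ → ℕ → ℕ → Set
Φ {q} xs e i k = Result (machine q e) xs (initial i) k

------------------------------------------------------------------------
-- Partial recursive functions over 𝒩

data Codomain : Set where
  num seq : Codomain

⟦_⟧ : Codomain → Set
⟦ num ⟧ = ℕ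
⟦ seq ⟧ = 𝒩

-- Functions of p numerical and q sequence arguments.  The condition
-- p + q ≥ 1 has to be imposed for μ only; all other constructors preserve it.
data PR : ℕ → ℕ → Codomain → Set where
  zero   : PR 1 0 num
  succ   : PR 1 0 num
  projₙ  : Fin p → PR p q num
  projₛ  : Fin q → PR p q seq
  Ψ      : ∀ q → PR 1 q seq
  χ      : PR 0 1 num
  comp   : ∀ {c} → PR p q c → Vec (PR p′ q′ num) p → Vec (PR p′ q′ seq) q →
           PR p′ q′ c
  primₙ  : PR p q num → PR (suc (suc p)) q num → PR (suc p) q num
  primₛ  : PR p q seq → PR (suc p) (suc q) seq → PR (suc p) q seq
  μ      : .{{NonZero (p + q)}} → PR (suc p) q num → PR p q num

-- The graph: Eval f ns xs v means that f(ns; xs) is defined with value v,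
-- where sequence values are determined up to pointwise equality.
-- Being different from 0_𝒩 is read positively, as having a nonzero entry;
-- classically this is the negation of being pointwise zero.
data Eval : ∀ {c} → PR p q c → Vec ℕ p → Vec 𝒩 q → ⟦ c ⟧ → Set where
  zero   : ∀ {n} → Eval zero (n ∷ []) [] 0
  succ   : ∀ {n} → Eval succ (n ∷ []) [] (suc n)
  projₙ  : ∀ {ns : Vec ℕ p} {xs : Vec 𝒩 q} i →
           Eval (projₙ i) ns xs (Vec.lookup ns i)
  projₛ  : ∀ {ns : Vec ℕ p} {xs : Vec 𝒩 q} j →
           Eval (projₛ j) ns xs (Vec.lookup xs j)
  Ψ      : ∀ {e} {xs : Vec 𝒩 q} {y : 𝒩} → (∀ i → Φ xs e i (y i)) →
           Eval (Ψ q) (e ∷ []) xs y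
  χ-zero : ∀ {x} → (∀ i → x i ≡ 0) → Eval χ [] (x ∷ []) 1
  χ-else : ∀ {x} → ∃[ i ] x i ≢ 0 → Eval χ [] (x ∷ []) 0
  comp   : ∀ {c} {f : PR p q c}
           {gs : Vec (PR p′ q′ num) p} {hs : Vec (PR p′ q′ seq) q}
           {ms ys} {ns : Vec ℕ p} {xs : Vec 𝒩 q} {v} →
           Pointwise (λ g n → Eval g ms ys n) gs ns →
           Pointwise (λ h x → Eval h ms ys x) hs xs →
           Eval f ns xs v → Eval (comp f gs hs) ms ys v
  primₙ-zero : ∀ {G : PR p q num} {H ns xs v} →
           Eval G ns xs v → Eval (primₙ G H) (0 ∷ ns) xs v
  primₙ-suc  : ∀ {G : PR p q num} {H k ns xs u v} →
           Eval (primₙ G H) (k ∷ ns) xs u → Eval H (k ∷ (ns ∷ʳ u)) xs v →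
           Eval (primₙ G H) (suc k ∷ ns) xs v
  primₛ-zero : ∀ {G : PR p q seq} {H ns xs v} →
           Eval G ns xs v → Eval (primₛ G H) (0 ∷ ns) xs v
  primₛ-suc  : ∀ {G : PR p q seq} {H k ns xs u v} →
           Eval (primₛ G H) (k ∷ ns) xs u → Eval H (k ∷ ns) (xs ∷ʳ u) v →
           Eval (primₛ G H) (suc k ∷ ns) xs v
  μ      : .{{_ : NonZero (p + q)}} {G : PR (suc p) q num} → ∀ {ns xs k} →
           (∀ {k′} → k′ < k → ∃[ v ] Eval G (k′ ∷ ns) xs (suc v)) →
           Eval G (k ∷ ns) xs 0 → Eval (μ G) ns xs k

-- f computes the characteristic function of A and is total, so every x falls
-- under one of the two cases (classically, membership in A is decided anyway).
IsCharacteristic : Pred 𝒩 ℓ → PR 0 1 num → Set ℓ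
IsCharacteristic A f =
  ∀ x → (x ∈ A × Eval f [] (x ∷ []) 1) ⊎ (x ∉ A × Eval f [] (x ∷ []) 0)

RecursiveOver𝒩 : Pred 𝒩 ℓ → Set ℓ
RecursiveOver𝒩 A = ∃[ f ] IsCharacteristic A f

------------------------------------------------------------------------
-- Recursive functions on the natural numbers

data Rec : ℕ → Set where
  zero : Rec n
  succ : Rec 1
  proj : Fin n → Rec n
  comp : Rec m → Vec (Rec n) m → Rec n
  prim : Rec n → Rec (suc (suc n)) → Rec (suc n)
  μ    : Rec (suc n) → Rec n

data EvalRec : Rec n → Vec ℕ n → ℕ → Set where
  zero : {ns : Vec ℕ n} → EvalRec zero ns 0
  succ : ∀ {k} → EvalRec succ (k ∷ []) (suc k)
  proj : {ns : Vec ℕ n} → ∀ i → EvalRec (proj i) ns (Vec.lookup ns i)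
  comp : ∀ {f : Rec m} {gs : Vec (Rec n) m} {ns ms v} →
         Pointwise (λ g k → EvalRec g ns k) gs ms → EvalRec f ms v →
         EvalRec (comp f gs) ns v
  prim-zero : ∀ {G : Rec n} {H ns v} → EvalRec G ns v →
         EvalRec (prim G H) (0 ∷ ns) v
  prim-suc  : ∀ {G : Rec n} {H k ns u v} → EvalRec (prim G H) (k ∷ ns) u →
         EvalRec H (k ∷ (ns ∷ʳ u)) v → EvalRec (prim G H) (suc k ∷ ns) v
  μ    : ∀ {G : Rec (suc n)} {ns k} →
         (∀ {k′} → k′ < k → ∃[ v ] EvalRec G (k′ ∷ ns) (suc v)) →
         EvalRec G (k ∷ ns) 0 → EvalRec (μ G) ns k

RecursiveDoubleSequence : (ℕ → ℕ → List ℕ) → Set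
RecursiveDoubleSequence σ =
  ∃[ f ] (∀ i j → EvalRec {2} f (i ∷ j ∷ []) (encode (σ i j)))

------------------------------------------------------------------------
-- The effective Borel classes

_≺_ : List ℕ → 𝒩 → Set
σ ≺ f = ∀ (k : Fin (length σ)) → List.lookup σ k ≡ f (toℕ k)

Cylinder : List ℕ → Pred 𝒩 _
Cylinder σ f = σ ≺ f

Π⁰₂ : Pred 𝒩 ℓ → Set ℓ
Π⁰₂ A = Σ[ σ ∈ (ℕ → ℕ → List ℕ) ]
  RecursiveDoubleSequence σ × A ≐ (⋂[ i ∶ ℕ ] ⋃[ j ∶ ℕ ] Cylinder (σ i j))

Σ⁰₂ : Pred 𝒩 ℓ → Set ℓ
Σ⁰₂ A = Π⁰₂ (∁ A)

Δ⁰₂ : Pred 𝒩 ℓ → Set ℓ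
Δ⁰₂ A = Σ⁰₂ A × Π⁰₂ A

{-# OPTIONS --safe #-}
module Submission where

-- Sequences can only be produced from the argument x by machines, and χ answers
-- a Σ⁰₁ or Π⁰₁ question about such a sequence.  Once the answers of χ are guessed,
-- together with the values of μ, all numbers in a computation are known and all
-- sequences are approximated by finite tables computed from an initial segment
-- of x.  A wrong guess is contradicted by a long enough segment of x: a sequence
-- guessed to be zero shows a nonzero entry, or an entry guessed to be nonzero
-- shows the value 0.  A correct list of guesses is never contradicted.  So, for a
-- characteristic function f, "f(x) ≠ b" means that every list of guesses leads to
-- a contradiction or to a value other than b on some initial segment of x.  This
-- is a Π⁰₂ condition; taking b = 0 and b = 1 gives both A and its complement.

open import Defs
open import Level using (Level)
open import Relation.Unary using (Pred; _∈_; _∉_; ∁)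
open import Data.Bool.Base using (Bool; true; false; if_then_else_; _∧_; T)
open import Data.Bool.Properties using () renaming (_≟_ to _≟ᵇ_)
open import Data.Empty using (⊥; ⊥-elim)
open import Data.Fin.Base using (Fin; zero; suc; toℕ)
open import Data.Fin.Patterns using (0F; 1F; 2F; 3F)
open import Data.Fin.Properties using (toℕ-fromℕ<)
open import Data.List.Base as List
  using (List; []; _∷_; _++_; length; uncons; foldl; foldr; replicate; dropWhileᵇ;
         applyUpTo; applyDownFrom)
open import Data.List.Properties
  using (reverse-foldl; reverse-applyDownFrom; ++-identityʳ; length-applyUpTo;
         lookup-applyUpTo; map-applyUpTo)
open import Data.Maybe.Base as Maybe using (Maybe; just; nothing; maybe; _>>=_)
open import Data.Nat.Base
  using (ℕ; zero; suc; pred; _+_; _*_; _∸_; _^_; _%_; _≡ᵇ_; _⊔_; _≤_; _<_; z≤n; s≤s;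
         _≤′_; ≤′-refl; ≤′-step)
open import Data.Nat.DivMod using (_mod_; %-distribˡ-+; m<n⇒m%n≡m; n%n≡0; m%n<n)
open import Data.Nat.Properties
open import Data.Product.Base using (Σ-syntax; ∃-syntax; _×_; _,_; proj₁; proj₂; uncurry)
open import Data.Sum.Base using (_⊎_; inj₁; inj₂)
open import Data.Vec.Base as Vec using (Vec; []; _∷_; _∷ʳ_; head; tail; lookup)
open import Data.Vec.Properties using (map-∷ʳ; lookup-map)
open import Data.Vec.Relation.Binary.Pointwise.Inductive as Pointwise
  using (Pointwise; []; _∷_; Pointwise-≡⇒≡)
open import Function.Base using (_$_; _∘_; flip; id)
open import Relation.Binary.Definitions using (tri<; tri≈; tri>)
open import Relation.Binary.PropositionalEquality
open import Relation.Nullary.Decidable.Core using (does)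
open import Relation.Nullary.Negation using (¬_; contradiction)

-- The obstacle is partiality: after a wrong intermediate value a computation may reach arguments at
-- which a subterm has no value, and nothing could be said about it. Evaluation is therefore a total
-- function bounded by a stage, and what is proved about it starts from a derivation in `Eval`. Up
-- to the first wrong guess all arguments are the true ones, so derivations are at hand; the first
-- wrong guess turns the whole evaluation into `nothing` from some stage on, whatever the rest does.
-- A guess stands until it is refuted, instead of waiting for confirmation, because no finite table
-- confirms that a sequence is zero. A list of guesses is a single number read through `pair`: since
-- `π₁` and `π₂` are total, every number supplies infinitely many guesses, and quantifying over
-- lists of guesses is quantifying over ℕ.

private variable
  ℓ : Level
  X Y : Set
  k m n p q : ℕ

-- Recursive functions on numbers

record Recursive (h : Vec ℕ n → ℕ) : Set where
  constructor recursive
  field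
    program : Rec n
    correct : ∀ ns → EvalRec program ns (h ns)

-- Records, so that h can be inferred from the proof.
record Recursive₁ (h : ℕ → ℕ) : Set where
  constructor unary
  field recursive₁ : Recursive {1} λ ns → h (head ns)

record Recursive₂ (h : ℕ → ℕ → ℕ) : Set where
  constructor binary
  field recursive₂ : Recursive {2} λ ns → h (head ns) (head (tail ns))

record Recursive₃ (h : ℕ → ℕ → ℕ → ℕ) : Set where
  constructor ternary
  field
    recursive₃ :
      Recursive {3} λ ns → h (head ns) (head (tail ns)) (head (tail (tail ns)))

sucᴿ : Recursive₁ suc
sucᴿ = unary (recursive succ λ { (_ ∷ []) → succ })

module _ {n : ℕ} where

  argᴿ : (i : Fin n) → Recursive (λ ns → lookup ns i)
  argᴿ i = recursive (proj i) (λ _ → proj i)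

  apᴿ₁ : ∀ {h g} → Recursive₁ h → Recursive {n} g → Recursive (λ ns → h (g ns))
  apᴿ₁ (unary (recursive r e)) (recursive s d) =
    recursive (comp r (s ∷ [])) λ ns → comp (d ns ∷ []) (e _)

  apᴿ₂ : ∀ {h g₁ g₂} → Recursive₂ h → Recursive {n} g₁ → Recursive {n} g₂ →
         Recursive (λ ns → h (g₁ ns) (g₂ ns))
  apᴿ₂ (binary (recursive r e)) (recursive s₁ d₁) (recursive s₂ d₂) =
    recursive (comp r (s₁ ∷ s₂ ∷ [])) λ ns → comp (d₁ ns ∷ d₂ ns ∷ []) (e _)

  apᴿ₃ : ∀ {h g₁ g₂ g₃} → Recursive₃ h →
         Recursive {n} g₁ → Recursive {n} g₂ → Recursive {n} g₃ →
         Recursive (λ ns → h (g₁ ns) (g₂ ns) (g₃ ns))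
  apᴿ₃ (ternary (recursive r e)) (recursive s₁ d₁) (recursive s₂ d₂) (recursive s₃ d₃) =
    recursive (comp r (s₁ ∷ s₂ ∷ s₃ ∷ [])) λ ns →
      comp (d₁ ns ∷ d₂ ns ∷ d₃ ns ∷ []) (e _)

  headᴿ : Recursive {suc n} head
  headᴿ = recursive (proj zero) λ { (_ ∷ _) → proj zero }

  primᴿ : ∀ {g h} (f : ℕ → Vec ℕ n → ℕ) → Recursive g → Recursive h →
          (∀ ns → g ns ≡ f 0 ns) →
          (∀ k ns → h (k ∷ (ns ∷ʳ f k ns)) ≡ f (suc k) ns) →
          Recursive (λ ns → f (head ns) (tail ns))
  primᴿ {g} {h} f (recursive r d) (recursive s e) f-zero f-suc =
    recursive (prim r s) λ { (k ∷ ns) → eval k ns }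
    where
    eval : ∀ k ns → EvalRec (prim r s) (k ∷ ns) (f k ns)
    eval zero    ns = subst (EvalRec _ _) (f-zero ns) (prim-zero (d ns))
    eval (suc k) ns =
      subst (EvalRec _ _) (f-suc k ns) (prim-suc (eval k ns) (e _))

  constᴿ : ∀ k → Recursive {n} (λ _ → k)
  constᴿ zero    = recursive zero (λ _ → zero)
  constᴿ (suc k) = apᴿ₁ sucᴿ (constᴿ k)

predᴿ : Recursive₁ pred
predᴿ = unary $ primᴿ (λ k _ → pred k) (constᴿ 0) (argᴿ 0F) (λ _ → refl) (λ _ _ → refl)

ifZero : ∀ {a} {A : Set a} → ℕ → A → A → A
ifZero zero    a b = a
ifZero (suc _) a b = b

ifZeroᴿ : Recursive₃ ifZero
ifZeroᴿ = ternary $ primᴿ (λ k ns → ifZero k (head ns) (head (tail ns))) (argᴿ 0F) (argᴿ 2F)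
  (λ { (_ ∷ _ ∷ []) → refl }) (λ { _ (_ ∷ _ ∷ []) → refl })

double-suc : ∀ n → 2 * suc n ≡ suc (suc (2 * n))
double-suc n = cong suc (+-suc n (n + 0))

doubleᴿ : Recursive₁ (2 *_)
doubleᴿ = unary $ primᴿ (λ k _ → 2 * k) (constᴿ 0) (apᴿ₁ sucᴿ (apᴿ₁ sucᴿ (argᴿ 1F)))
  (λ _ → refl) (λ { k [] → sym (double-suc k) })

parity : ℕ → ℕ
parity zero    = 0
parity (suc n) = ifZero (parity n) 1 0

parityᴿ : Recursive₁ parity
parityᴿ = unary $ primᴿ (λ k _ → parity k) (constᴿ 0)
  (apᴿ₃ ifZeroᴿ (argᴿ 1F) (constᴿ 1) (constᴿ 0)) (λ _ → refl) (λ { _ [] → refl })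

half : ℕ → ℕ
half zero    = 0
half (suc n) = ifZero (parity n) (half n) (suc (half n))

halfᴿ : Recursive₁ half
halfᴿ = unary $ primᴿ (λ k _ → half k) (constᴿ 0)
  (apᴿ₃ ifZeroᴿ (apᴿ₁ parityᴿ (argᴿ 0F)) (argᴿ 1F) (apᴿ₁ sucᴿ (argᴿ 1F)))
  (λ _ → refl) (λ { _ [] → refl })

parity-even : ∀ n → parity (2 * n) ≡ 0
parity-even zero    = refl
parity-even (suc n) = trans (cong parity (double-suc n)) double-step
  where
  double-step : parity (suc (suc (2 * n))) ≡ 0
  double-step rewrite parity-even n = refl

parity-odd : ∀ n → parity (suc (2 * n)) ≡ 1
parity-odd n rewrite parity-even n = refl

half-even : ∀ n → half (2 * n) ≡ n
half-even zero    = refl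
half-even (suc n) = trans (cong half (double-suc n)) double-step
  where
  double-step : half (suc (suc (2 * n))) ≡ suc n
  double-step rewrite parity-even n = cong suc (half-even n)

half-odd : ∀ n → half (suc (2 * n)) ≡ n
half-odd n rewrite parity-even n = half-even n

-- The pairing function that is iterated in `encode`.
pair : ℕ → ℕ → ℕ
pair a b = 2 ^ a * suc (2 * b)

pair-zero : ∀ b → pair 0 b ≡ suc (2 * b)
pair-zero b = *-identityˡ _

pair-suc : ∀ a b → pair (suc a) b ≡ 2 * pair a b
pair-suc a b = *-assoc 2 (2 ^ a) _

pairᴿ : Recursive₂ pair
pairᴿ = binary $ primᴿ (λ a ns → pair a (head ns))
  (apᴿ₁ sucᴿ (apᴿ₁ doubleᴿ (argᴿ 0F))) (apᴿ₁ doubleᴿ (argᴿ 2F))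
  (λ { (b ∷ []) → sym (pair-zero b) }) (λ { a (b ∷ []) → sym (pair-suc a b) })

shift : ℕ → ℕ
shift n = ifZero (parity n) (half n) n

strip : ℕ → ℕ → ℕ
strip zero    n = n
strip (suc k) n = shift (strip k n)

stripped : ℕ → ℕ → ℕ
stripped zero    n = 0
stripped (suc k) n =
  ifZero (parity (strip k n)) (suc (stripped k n)) (stripped k n)

-- Halving as long as possible leaves the odd factor of `pair a b`. Since `a ≤ pair a b`, the number
-- itself bounds the rounds, so primitive recursion is enough.
π₁ π₂ : ℕ → ℕ
π₁ n = stripped n n
π₂ n = half (strip n n)

stripᴿ : Recursive₂ strip
stripᴿ = binary $ primᴿ (λ k ns → strip k (head ns)) (argᴿ 0F)
  (apᴿ₃ ifZeroᴿ (apᴿ₁ parityᴿ (argᴿ 2F)) (apᴿ₁ halfᴿ (argᴿ 2F)) (argᴿ 2F))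
  (λ { (_ ∷ []) → refl }) (λ { _ (_ ∷ []) → refl })

strippedᴿ : Recursive₂ stripped
strippedᴿ = binary $ primᴿ (λ k ns → stripped k (head ns)) (constᴿ 0)
  (apᴿ₃ ifZeroᴿ (apᴿ₁ parityᴿ (apᴿ₂ stripᴿ (argᴿ 0F) (argᴿ 1F)))
    (apᴿ₁ sucᴿ (argᴿ 2F)) (argᴿ 2F))
  (λ _ → refl) (λ { _ (_ ∷ []) → refl })

π₁ᴿ : Recursive₁ π₁
π₁ᴿ = unary (apᴿ₂ strippedᴿ headᴿ headᴿ)

π₂ᴿ : Recursive₁ π₂
π₂ᴿ = unary (apᴿ₁ halfᴿ (apᴿ₂ stripᴿ headᴿ headᴿ))

parity-pair-zero : ∀ b → parity (pair 0 b) ≡ 1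
parity-pair-zero b = trans (cong parity (pair-zero b)) (parity-odd b)

parity-pair-suc : ∀ a b → parity (pair (suc a) b) ≡ 0
parity-pair-suc a b = trans (cong parity (pair-suc a b)) (parity-even (pair a b))

shift-pair : ∀ a b → shift (pair a b) ≡ pair (pred a) b
shift-pair zero b = cong (λ p → ifZero p (half (pair 0 b)) (pair 0 b)) (parity-pair-zero b)
shift-pair (suc a) b =
  trans (cong (λ p → ifZero p (half (pair (suc a) b)) (pair (suc a) b)) (parity-pair-suc a b))
    (trans (cong half (pair-suc a b)) (half-even (pair a b)))

strip-pair : ∀ k a b → strip k (pair a b) ≡ pair (a ∸ k) b
strip-pair zero    a b = refl
strip-pair (suc k) a b = trans (cong shift (strip-pair k a b))
  (trans (shift-pair (a ∸ k) b) (cong (λ d → pair d b) (pred[m∸n]≡m∸[1+n] a k)))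

-- An invariant: every round moves one unit from the remaining exponent to the counter until the
-- exponent is used up.
stripped-pair : ∀ k a b → stripped k (pair a b) + (a ∸ k) ≡ a
stripped-pair zero    a b = refl
stripped-pair (suc k) a b = trans
  (cong₂ (λ p d → ifZero p (suc t) t + d)
    (cong parity (strip-pair k a b)) (sym (pred[m∸n]≡m∸[1+n] a k)))
  (count (a ∸ k) (stripped-pair k a b))
  where
  t = stripped k (pair a b)

  count : ∀ d → t + d ≡ a → ifZero (parity (pair d b)) (suc t) t + pred d ≡ a
  count zero    eq =
    trans (cong (λ p → ifZero p (suc t) t + 0) (parity-pair-zero b)) eq
  count (suc d) eq =
    trans (cong (λ p → ifZero p (suc t) t + d) (parity-pair-suc d b))
      (trans (sym (+-suc t d)) eq)

a≤2^a : ∀ a → a ≤ 2 ^ a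
a≤2^a zero    = z≤n
a≤2^a (suc a) = +-mono-≤ (m^n>0 2 a) (≤-trans (a≤2^a a) (m≤m+n _ 0))

a≤pair : ∀ a b → a ≤ pair a b
a≤pair a b = ≤-trans (a≤2^a a) (m≤m*n (2 ^ a) (suc (2 * b)))

b<pair : ∀ a b → suc b ≤ pair a b
b<pair a b = ≤-trans (s≤s (m≤m+n b _)) (m≤n*m (suc (2 * b)) (2 ^ a) {{m^n≢0 2 a}})

π₁-pair : ∀ a b → π₁ (pair a b) ≡ a
π₁-pair a b = trans (sym (+-identityʳ _))
  (trans (cong (stripped (pair a b) (pair a b) +_) (sym (m≤n⇒m∸n≡0 (a≤pair a b))))
    (stripped-pair (pair a b) a b))

π₂-pair : ∀ a b → π₂ (pair a b) ≡ b
π₂-pair a b = trans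
  (cong half (trans (strip-pair (pair a b) a b)
    (trans (cong (λ d → pair d b) (m≤n⇒m∸n≡0 (a≤pair a b))) (pair-zero b))))
  (half-odd b)

-- Computable functions on coded data

infixr 4 _⊗_

data Type : Set where
  nat bool config : Type
  fin             : ℕ → Type
  option list     : Type → Type
  vec             : Type → ℕ → Type
  _⊗_             : Type → Type → Type

El : Type → Set
El nat       = ℕ
El bool      = Bool
El config    = Config
El (fin n)   = Fin n
El (option A) = Maybe (El A)
El (list A)  = List (El A)
El (vec A n) = Vec (El A) n
El (A ⊗ B)   = El A × El B

codeBool : Bool → ℕ
codeBool false = 0
codeBool true  = 1

codeList : ∀ {A : Set} → (A → ℕ) → List A → ℕ
codeList c []      = 0
codeList c (a ∷ l) = pair (c a) (codeList c l)

codeVec : ∀ {A : Set} → (A → ℕ) → Vec A n → ℕ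
codeVec c []      = 0
codeVec c (a ∷ v) = pair (c a) (codeVec c v)

code : ∀ A → El A → ℕ
code nat        n              = n
code bool       b              = codeBool b
code config     (config s l r) = pair s (pair (codeList codeBool l) (codeList codeBool r))
code (fin n)    i              = toℕ i
code (option A) nothing        = 0
code (option A) (just a)       = suc (code A a)
code (list A)   l              = codeList (code A) l
code (vec A n)  v              = codeVec (code A) v
code (A ⊗ B)    (a , b)        = pair (code A a) (code B b)

private variable
  Γ A B C : Type

-- The tracker is constrained on codes only, so no test for being a code ever has to be computed.
record Computable Γ A (F : El Γ → El A) : Set where
  constructor computable
  field
    tracker           : ℕ → ℕ
    tracker-recursive : Recursive₁ tracker
    tracks            : ∀ γ → tracker (code Γ γ) ≡ code A (F γ)

computable-ext : ∀ {F G} → (∀ γ → F γ ≡ G γ) → Computable Γ A F → Computable Γ A G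
computable-ext {A = A} F≗G (computable h r t) =
  computable h r λ γ → trans (t γ) (cong (code A) (F≗G γ))

lift₁ : ∀ {h} (F : El A → El B) → Recursive₁ h → (∀ a → h (code A a) ≡ code B (F a)) →
        ∀ {G} → Computable Γ A G → Computable Γ B (λ γ → F (G γ))
lift₁ {h = h} F r t (computable g s u) =
  computable (λ n → h (g n)) (unary (apᴿ₁ r (apᴿ₁ s headᴿ)))
    λ γ → trans (cong h (u γ)) (t _)

lift₂ : ∀ {h} (F : El A → El B → El C) → Recursive₂ h →
        (∀ a b → h (code A a) (code B b) ≡ code C (F a b)) →
        ∀ {G H} → Computable Γ A G → Computable Γ B H → Computable Γ C (λ γ → F (G γ) (H γ))
lift₂ {h = h} F r t (computable g s u) (computable g′ s′ u′) =
  computable (λ n → h (g n) (g′ n)) (unary (apᴿ₂ r (apᴿ₁ s headᴿ) (apᴿ₁ s′ headᴿ)))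
    λ γ → trans (cong₂ h (u γ) (u′ γ)) (t _ _)

id-recursive : Recursive₁ id
id-recursive = unary headᴿ

infixr 9 _∘ᶜ_
_∘ᶜ_ : ∀ {F G} → Computable B C F → Computable A B G → Computable A C (λ γ → F (G γ))
_∘ᶜ_ {F = F} (computable _ r t) c = lift₁ F r t c

varᶜ : Computable A A id
varᶜ = computable id id-recursive λ _ → refl

constᶜ : ∀ a → Computable Γ A (λ _ → a)
constᶜ {A = A} a = computable (λ _ → code A a) (unary (constᴿ (code A a))) λ _ → refl

infixr 4 _,ᶜ_
_,ᶜ_ : ∀ {F G} → Computable Γ A F → Computable Γ B G → Computable Γ (A ⊗ B) (λ γ → F γ , G γ)
_,ᶜ_ = lift₂ _,_ pairᴿ λ _ _ → refl

fstᶜ : ∀ {F} → Computable Γ (A ⊗ B) F → Computable Γ A (λ γ → proj₁ (F γ))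
fstᶜ {A = A} {B} = lift₁ proj₁ π₁ᴿ λ (a , b) → π₁-pair (code A a) (code B b)

sndᶜ : ∀ {F} → Computable Γ (A ⊗ B) F → Computable Γ B (λ γ → proj₂ (F γ))
sndᶜ {A = A} {B} = lift₁ proj₂ π₂ᴿ λ (a , b) → π₂-pair (code A a) (code B b)

weaken : ∀ {F} → Computable Γ A F → Computable (Γ ⊗ B) A (λ γ → F (proj₁ γ))
weaken f = f ∘ᶜ fstᶜ varᶜ

sucᶜ : ∀ {F} → Computable Γ nat F → Computable Γ nat (λ γ → suc (F γ))
sucᶜ = lift₁ suc sucᴿ λ _ → refl

ifᶜ : ∀ {P F G} → Computable Γ bool P → Computable Γ A F → Computable Γ A G →
      Computable Γ A (λ γ → if P γ then F γ else G γ)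
ifᶜ {Γ} {A} {P} {F} {G} (computable p r t) (computable f s u) (computable g s′ u′) =
  computable (λ n → ifZero (p n) (g n) (f n))
    (unary (apᴿ₃ ifZeroᴿ (apᴿ₁ r headᴿ) (apᴿ₁ s′ headᴿ) (apᴿ₁ s headᴿ)))
    λ γ → trans (cong (λ b → ifZero b (g (code Γ γ)) (f (code Γ γ))) (t γ)) (choose γ (P γ))
  where
  choose : ∀ γ b → ifZero (codeBool b) (g (code Γ γ)) (f (code Γ γ)) ≡
                   code A (if b then F γ else G γ)
  choose γ true  = u γ
  choose γ false = u′ γ

-- `F` is any function satisfying the recursion equations. A definition by pattern matching can thus
-- be tracked as it stands, without first being rewritten with a recursor.
primᶜ : ∀ {Z S N} (F : El Γ → ℕ → El A) →
        Computable Γ A Z → Computable (Γ ⊗ nat ⊗ A) A S →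
        (∀ γ → Z γ ≡ F γ 0) → (∀ γ k → S (γ , k , F γ k) ≡ F γ (suc k)) →
        Computable Γ nat N → Computable Γ A (λ γ → F γ (N γ))
primᶜ {Γ} {A} {N = N} F (computable z r t) (computable s q u) F-zero F-suc (computable n v w) =
  computable (λ g → rec (n g) g) (unary (apᴿ₂ recᴿ (apᴿ₁ v headᴿ) headᴿ))
    λ γ → trans (cong (λ k → rec k (code Γ γ)) (w γ)) (rec-tracks γ (N γ))
  where
  rec : ℕ → ℕ → ℕ
  rec zero    g = z g
  rec (suc k) g = s (pair g (pair k (rec k g)))

  recᴿ : Recursive₂ rec
  recᴿ = binary $ primᴿ (λ k ns → rec k (head ns)) (apᴿ₁ r headᴿ)
    (apᴿ₁ q (apᴿ₂ pairᴿ (argᴿ 1F) (apᴿ₂ pairᴿ (argᴿ 0F) (argᴿ 2F))))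
    (λ { (_ ∷ []) → refl }) (λ { _ (_ ∷ []) → refl })

  rec-tracks : ∀ γ k → rec k (code Γ γ) ≡ code A (F γ k)
  rec-tracks γ zero    = trans (t γ) (cong (code A) (F-zero γ))
  rec-tracks γ (suc k) =
    trans (cong (λ n → s (pair (code Γ γ) (pair k n))) (rec-tracks γ k))
      (trans (u _) (cong (code A) (F-suc γ k)))

caseNatᶜ : ∀ {N Z S} (F : El Γ → ℕ → El A) →
           Computable Γ A Z → Computable (Γ ⊗ nat) A S →
           (∀ γ → Z γ ≡ F γ 0) → (∀ γ k → S (γ , k) ≡ F γ (suc k)) →
           Computable Γ nat N → Computable Γ A (λ γ → F γ (N γ))
caseNatᶜ F z s = primᶜ F z (s ∘ᶜ (fstᶜ varᶜ ,ᶜ fstᶜ (sndᶜ varᶜ)))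

nothingᶜ : Computable Γ (option A) (λ _ → nothing)
nothingᶜ = constᶜ nothing

justᶜ : ∀ {F} → Computable Γ A F → Computable Γ (option A) (λ γ → just (F γ))
justᶜ = lift₁ just sucᴿ λ _ → refl

maybeᶜ : ∀ {M J N} → Computable Γ (option A) M → Computable (Γ ⊗ A) B J → Computable Γ B N →
         Computable Γ B (λ γ → maybe (λ a → J (γ , a)) (N γ) (M γ))
maybeᶜ {Γ} {A} {B} {M} {J} {N} (computable m r t) (computable j s u) (computable n v w) =
  computable (λ g → select g (m g))
    (unary (apᴿ₃ ifZeroᴿ (apᴿ₁ r headᴿ) (apᴿ₁ v headᴿ)
      (apᴿ₁ s (apᴿ₂ pairᴿ headᴿ (apᴿ₁ predᴿ (apᴿ₁ r headᴿ))))))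
    λ γ → trans (cong (select (code Γ γ)) (t γ)) (choose γ (M γ))
  where
  select : ℕ → ℕ → ℕ
  select g k = ifZero k (n g) (j (pair g (pred k)))

  choose : ∀ γ a? → select (code Γ γ) (code (option A) a?) ≡
                    code B (maybe (λ a → J (γ , a)) (N γ) a?)
  choose γ nothing  = w γ
  choose γ (just a) = u (γ , a)

infixl 1 _>>=ᶜ_
_>>=ᶜ_ : ∀ {M K} → Computable Γ (option A) M → Computable (Γ ⊗ A) (option B) K →
         Computable Γ (option B) (λ γ → M γ >>= λ a → K (γ , a))
_>>=ᶜ_ {M = M} {K} m k = computable-ext (λ γ → bind γ (M γ)) (maybeᶜ m k nothingᶜ)
  where
  bind : ∀ γ m → maybe (λ a → K (γ , a)) nothing m ≡ (m >>= λ a → K (γ , a))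
  bind γ nothing  = refl
  bind γ (just a) = refl

configᶜ : ∀ {F G H} → Computable Γ nat F →
          Computable Γ (list bool) G → Computable Γ (list bool) H →
          Computable Γ config (λ γ → config (F γ) (G γ) (H γ))
configᶜ s l r = lift₁ (λ (s , l , r) → config s l r) id-recursive (λ _ → refl) (s ,ᶜ l ,ᶜ r)

fieldsᶜ : ∀ {F} → Computable Γ config F →
          Computable Γ (nat ⊗ list bool ⊗ list bool)
            (λ γ → Config.state (F γ) , Config.leftward (F γ) , Config.rightward (F γ))
fieldsᶜ = lift₁ (λ (config s l r) → s , l , r) id-recursive λ _ → refl

isZero : ℕ → Bool
isZero zero    = true
isZero (suc _) = false

isZeroᶜ : ∀ {F} → Computable Γ nat F → Computable Γ bool (λ γ → isZero (F γ))
isZeroᶜ = caseNatᶜ (λ _ → isZero) (constᶜ true) (constᶜ false) (λ _ → refl) (λ _ _ → refl)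

predᶜ : ∀ {F} → Computable Γ nat F → Computable Γ nat (λ γ → pred (F γ))
predᶜ = lift₁ pred predᴿ λ _ → refl

∧ᶜ : ∀ {F G} → Computable Γ bool F → Computable Γ bool G → Computable Γ bool (λ γ → F γ ∧ G γ)
∧ᶜ {F = F} {G} p q = computable-ext (λ γ → and (F γ) (G γ)) (ifᶜ p q (constᶜ false))
  where
  and : ∀ b c → (if b then c else false) ≡ b ∧ c
  and true  c = refl
  and false c = refl

∸ᶜ : ∀ {F G} → Computable Γ nat F → Computable Γ nat G → Computable Γ nat (λ γ → F γ ∸ G γ)
∸ᶜ {F = F} m n = primᶜ (λ γ k → F γ ∸ k) m (predᶜ (sndᶜ (sndᶜ varᶜ)))
  (λ _ → refl) (λ γ k → pred[m∸n]≡m∸[1+n] (F γ) k) n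

≡ᵇ-∸ : ∀ m n → isZero (m ∸ n) ∧ isZero (n ∸ m) ≡ (m ≡ᵇ n)
≡ᵇ-∸ zero    zero    = refl
≡ᵇ-∸ zero    (suc n) = refl
≡ᵇ-∸ (suc m) zero    = refl
≡ᵇ-∸ (suc m) (suc n) = ≡ᵇ-∸ m n

≡ᵇᶜ : ∀ {F G} → Computable Γ nat F → Computable Γ nat G → Computable Γ bool (λ γ → F γ ≡ᵇ G γ)
≡ᵇᶜ {F = F} {G} m n = computable-ext (λ _ → ≡ᵇ-∸ (F _) (G _))
  (∧ᶜ (isZeroᶜ (∸ᶜ m n)) (isZeroᶜ (∸ᶜ n m)))

-- Lists: folds and structural recursion.

infixr 5 _∷ᶜ_
_∷ᶜ_ : ∀ {F G} → Computable Γ A F → Computable Γ (list A) G →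
       Computable Γ (list A) (λ γ → F γ ∷ G γ)
_∷ᶜ_ = lift₂ _∷_ pairᴿ λ _ _ → refl

-- Lets the code of a list serve as the number of rounds of a fold; surplus rounds act on the empty
-- list and change nothing.
code-list : ∀ A (l : List (El A)) → length l ≤ code (list A) l
code-list A []      = z≤n
code-list A (a ∷ l) = ≤-trans (s≤s (code-list A l)) (b<pair (code A a) (code (list A) l))

-- A nonempty list has the same code as the pair of its head and tail, so only the successor that
-- marks `just` is added.
unconsᶜ : ∀ {F} → Computable Γ (list A) F →
          Computable Γ (option (A ⊗ list A)) (λ γ → uncons (F γ))
unconsᶜ {A = A} = lift₁ uncons optionᴿ
  λ { [] → refl ; (a ∷ l) → positive (b<pair (code A a) (code (list A) l)) }
  where
  optionᴿ : Recursive₁ (λ n → ifZero n 0 (suc n))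
  optionᴿ = unary (apᴿ₃ ifZeroᴿ headᴿ (constᴿ 0) (apᴿ₁ sucᴿ headᴿ))

  positive : suc k ≤ n → ifZero n 0 (suc n) ≡ suc n
  positive (s≤s _) = refl

foldlᶜ : ∀ {S Z L} → Computable (Γ ⊗ B ⊗ A) B S → Computable Γ B Z → Computable Γ (list A) L →
         Computable Γ B (λ γ → foldl (λ b a → S (γ , b , a)) (Z γ) (L γ))
foldlᶜ {Γ} {B} {A} {S} {Z} {L} s z l =
  computable-ext (λ γ → cong proj₁ (iterate-all γ _ (Z γ) (L γ) (code-list A (L γ))))
    (fstᶜ (primᶜ (λ γ k → iterate γ k (Z γ , L γ))
      (z ,ᶜ l) (advanceᶜ ∘ᶜ (fstᶜ varᶜ ,ᶜ sndᶜ (sndᶜ varᶜ)))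
      (λ _ → refl) (λ _ _ → refl)
      (lift₁ (codeList (code A)) id-recursive (λ _ → refl) l)))
  where
  advance : El Γ → El B × List (El A) → El B × List (El A)
  advance γ (b , l) = maybe (λ (a , l′) → S (γ , b , a) , l′) (b , l) (uncons l)

  advanceᶜ : Computable (Γ ⊗ B ⊗ list A) (B ⊗ list A) (uncurry advance)
  advanceᶜ = maybeᶜ (unconsᶜ (sndᶜ (sndᶜ varᶜ)))
    (s ∘ᶜ (fstᶜ (fstᶜ varᶜ) ,ᶜ fstᶜ (sndᶜ (fstᶜ varᶜ)) ,ᶜ fstᶜ (sndᶜ varᶜ)) ,ᶜ sndᶜ (sndᶜ varᶜ))
    (sndᶜ varᶜ)

  iterate : El Γ → ℕ → El B × List (El A) → El B × List (El A)
  iterate γ zero    c = c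
  iterate γ (suc k) c = advance γ (iterate γ k c)

  -- `iterate` unfolds at its last round, whereas the fold consumes the list at its first.
  iterate-comm : ∀ γ k c → iterate γ k (advance γ c) ≡ iterate γ (suc k) c
  iterate-comm γ zero    c = refl
  iterate-comm γ (suc k) c = cong (advance γ) (iterate-comm γ k c)

  iterate-all : ∀ γ k b l → length l ≤ k →
                iterate γ k (b , l) ≡ (foldl (λ b a → S (γ , b , a)) b l , [])
  iterate-all γ zero    b []      _       = refl
  iterate-all γ (suc k) b []      _       =
    trans (sym (iterate-comm γ k _)) (iterate-all γ k b [] z≤n)
  iterate-all γ (suc k) b (a ∷ l) (s≤s p) =
    trans (sym (iterate-comm γ k _)) (iterate-all γ k _ l p)

nilᶜ : Computable Γ (list A) (λ _ → [])
nilᶜ = constᶜ []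

-- A left fold over the reversed list rebuilds the list next to the value.
listrecᶜ : ∀ {Z S L} (F : El Γ → List (El A) → El B) →
           Computable Γ B Z → Computable (Γ ⊗ A ⊗ list A ⊗ B) B S →
           (∀ γ → Z γ ≡ F γ []) → (∀ γ a l → S (γ , a , l , F γ l) ≡ F γ (a ∷ l)) →
           Computable Γ (list A) L → Computable Γ B (λ γ → F γ (L γ))
listrecᶜ {Γ} {A} {B} {Z} {S} {L} F z s F-[] F-∷ l = computable-ext
  (λ γ → trans
    (cong proj₂ (reverse-foldl (flip (extend γ)) ([] , Z γ) (L γ)))
    (cong proj₂ (extend-all γ (L γ))))
  (sndᶜ (foldlᶜ
    ((fstᶜ a,c ∷ᶜ fstᶜ (sndᶜ a,c)) ,ᶜ s ∘ᶜ (fstᶜ varᶜ ,ᶜ a,c))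
    (nilᶜ ,ᶜ z)
    (foldlᶜ (sndᶜ (sndᶜ varᶜ) ∷ᶜ fstᶜ (sndᶜ varᶜ)) nilᶜ l)))
  where
  extend : El Γ → El A → List (El A) × El B → List (El A) × El B
  extend γ a (l , b) = a ∷ l , S (γ , a , l , b)

  a,c : Computable (Γ ⊗ (list A ⊗ B) ⊗ A) (A ⊗ list A ⊗ B) _
  a,c = sndᶜ (sndᶜ varᶜ) ,ᶜ fstᶜ (sndᶜ varᶜ)

  extend-all : ∀ γ l → foldr (extend γ) ([] , Z γ) l ≡ (l , F γ l)
  extend-all γ []      = cong ([] ,_) (F-[] γ)
  extend-all γ (a ∷ l) =
    trans (cong (extend γ a) (extend-all γ l)) (cong (a ∷ l ,_) (F-∷ γ a l))

-- Vectors and finite index sets.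

vnilᶜ : Computable Γ (vec A 0) (λ _ → [])
vnilᶜ = constᶜ []

infixr 5 _∷ᵛ_
_∷ᵛ_ : ∀ {F G} → Computable Γ A F → Computable Γ (vec A n) G →
       Computable Γ (vec A (suc n)) (λ γ → F γ ∷ G γ)
_∷ᵛ_ = lift₂ _∷_ pairᴿ λ _ _ → refl

headᶜ : ∀ {F} → Computable Γ (vec A (suc n)) F → Computable Γ A (λ γ → head (F γ))
headᶜ {A = A} = lift₁ head π₁ᴿ λ { (a ∷ v) → π₁-pair (code A a) (codeVec (code A) v) }

tailᶜ : ∀ {F} → Computable Γ (vec A (suc n)) F → Computable Γ (vec A n) (λ γ → tail (F γ))
tailᶜ {A = A} = lift₁ tail π₂ᴿ λ { (a ∷ v) → π₂-pair (code A a) (codeVec (code A) v) }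

lookupᶜ : ∀ (i : Fin n) {F} → Computable Γ (vec A n) F → Computable Γ A (λ γ → lookup (F γ) i)
lookupᶜ i {F} v = computable-ext (λ γ → lookup-destruct (F γ) i) (destructᶜ i v)
  where
  destruct : ∀ {n} → Vec (El A) n → Fin n → El A
  destruct v zero    = head v
  destruct v (suc i) = destruct (tail v) i

  destructᶜ : ∀ {n} (i : Fin n) {F} → Computable Γ (vec A n) F →
              Computable Γ A (λ γ → destruct (F γ) i)
  destructᶜ zero    v = headᶜ v
  destructᶜ (suc i) v = destructᶜ i (tailᶜ v)

  lookup-destruct : ∀ {n} (v : Vec (El A) n) i → destruct v i ≡ lookup v i
  lookup-destruct (a ∷ v) zero    = refl
  lookup-destruct (a ∷ v) (suc i) = lookup-destruct v i

∷ʳᶜ : ∀ {F G} → Computable Γ (vec A n) F → Computable Γ A G →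
      Computable Γ (vec A (suc n)) (λ γ → F γ ∷ʳ G γ)
∷ʳᶜ {n = zero}  {F} {G} v a = computable-ext (λ γ → snoc (F γ)) (a ∷ᵛ vnilᶜ)
  where
  snoc : ∀ {A : Set} {a : A} (v : Vec A 0) → a ∷ [] ≡ v ∷ʳ a
  snoc [] = refl
∷ʳᶜ {n = suc n} {F} {G} v a = computable-ext (λ γ → snoc (F γ)) (headᶜ v ∷ᵛ ∷ʳᶜ (tailᶜ v) a)
  where
  snoc : ∀ {A : Set} {a : A} (v : Vec A (suc n)) → head v ∷ (tail v ∷ʳ a) ≡ v ∷ʳ a
  snoc (b ∷ v) = refl

finᶜ : ∀ {F : El Γ → Fin n} → Computable Γ nat (λ γ → toℕ (F γ)) → Computable Γ (fin n) F
finᶜ (computable f r t) = computable f r t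

-- Computability for each fixed index suffices, because finitely many trackers are joined by nested
-- case distinctions. This handles `query j`, where `lookupᶜ` wants the oracle index fixed.
caseFinᶜ : ∀ {F : Fin n → El Γ → El A} {I} → (∀ i → Computable Γ A (F i)) →
           Computable Γ (fin n) I → Computable Γ A (λ γ → F (I γ) γ)
caseFinᶜ {n} {Γ} {A} {F} {I} f (computable h r t) =
  computable (λ g → branch trackers (h g) g)
    (unary (apᴿ₂ (branchᴿ trackers λ i → Computable.tracker-recursive (f i))
      (apᴿ₁ r headᴿ) headᴿ))
    λ γ → trans (cong (λ k → branch trackers k (code Γ γ)) (t γ))
            (trans (branch-toℕ trackers (I γ) (code Γ γ)) (Computable.tracks (f (I γ)) γ))
  where
  trackers : Fin n → ℕ → ℕ
  trackers i = Computable.tracker (f i)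

  branch : ∀ {n} → (Fin n → ℕ → ℕ) → ℕ → ℕ → ℕ
  branch {zero}  hs k       g = 0
  branch {suc n} hs zero    g = hs zero g
  branch {suc n} hs (suc k) g = branch (hs ∘ suc) k g

  branchᴿ : ∀ {n} (hs : Fin n → ℕ → ℕ) → (∀ i → Recursive₁ (hs i)) → Recursive₂ (branch hs)
  branchᴿ {zero}  hs rs = binary (constᴿ 0)
  branchᴿ {suc n} hs rs = binary $ primᴿ (λ k ns → branch hs k (head ns)) (apᴿ₁ (rs zero) headᴿ)
    (apᴿ₂ (branchᴿ (hs ∘ suc) (rs ∘ suc)) (argᴿ 0F) (argᴿ 1F))
    (λ { (_ ∷ []) → refl }) (λ { _ (_ ∷ []) → refl })

  branch-toℕ : ∀ {n} hs (i : Fin n) g → branch hs (toℕ i) g ≡ hs i g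
  branch-toℕ hs zero    g = refl
  branch-toℕ hs (suc i) g = branch-toℕ (hs ∘ suc) i g

-- Presents the remainder as a counter that is reset at the modulus, which is the step of a
-- primitive recursion.
suc-% : ∀ a m → (if suc (a % suc m) ≡ᵇ suc m then 0 else suc (a % suc m)) ≡ suc a % suc m
suc-% a m = trans (small (m%n<n a (suc m)))
  (trans (%-distribˡ-+ 1 (a % suc m) (suc m))
    (trans (cong (λ r → (1 % suc m + r) % suc m) (m<n⇒m%n≡m (m%n<n a (suc m))))
      (sym (%-distribˡ-+ 1 a (suc m)))))
  where
  small : ∀ {r} → r < suc m → (if suc r ≡ᵇ suc m then 0 else suc r) ≡ suc r % suc m
  small {r} r<m with r ≡ᵇ m in eq
  ... | true  rewrite ≡ᵇ⇒≡ r m (subst T (sym eq) _) = sym (n%n≡0 (suc m))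
  ... | false = sym (m<n⇒m%n≡m (≤∧≢⇒< r<m λ { refl → subst T eq (≡⇒≡ᵇ r r refl) }))

modᶜ : ∀ {m F} → Computable Γ nat F → Computable Γ (fin (suc m)) (λ γ → F γ mod suc m)
modᶜ {m = m} {F} a = finᶜ (computable-ext (λ γ → sym (toℕ-fromℕ< (m%n<n (F γ) (suc m))))
  (primᶜ (λ _ k → k % suc m) (constᶜ 0)
    (ifᶜ (≡ᵇᶜ (sucᶜ r) (constᶜ (suc m))) (constᶜ 0) (sucᶜ r))
    (λ _ → refl) (λ _ k → suc-% k m) a))
  where
  r : ∀ {A B} → Computable (A ⊗ B ⊗ nat) nat _
  r = sndᶜ (sndᶜ varᶜ)

-- Coding of finite sequences

encode-next : ∀ σ → encode (next σ) ≡ suc (encode σ)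
encode-next []          = refl
encode-next (suc a ∷ σ) =
  trans (pair-zero (encode (a ∷ σ))) (cong suc (sym (pair-suc a (encode σ))))
encode-next (zero ∷ σ) with next σ | encode-next σ
... | []    | ()
... | a ∷ τ | eq = begin
  pair (suc a) (encode τ)      ≡⟨ pair-suc a (encode τ) ⟩
  2 * pair a (encode τ)        ≡⟨ cong (2 *_) eq ⟩
  2 * suc (encode σ)           ≡⟨ double-suc (encode σ) ⟩
  suc (suc (2 * encode σ))     ≡⟨ cong suc (pair-zero (encode σ)) ⟨
  suc (pair 0 (encode σ))      ∎
  where open ≡-Reasoning

encode-decode : ∀ n → encode (decode n) ≡ n
encode-decode zero    = refl
encode-decode (suc n) = trans (encode-next (decode n)) (cong suc (encode-decode n))

encode-injective : ∀ σ τ → encode σ ≡ encode τ → σ ≡ τ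
encode-injective []      []      eq = refl
encode-injective []      (b ∷ τ) eq
  with () ← subst (suc (encode τ) ≤_) (sym eq) (b<pair b (encode τ))
encode-injective (a ∷ σ) []      eq
  with () ← subst (suc (encode σ) ≤_) eq (b<pair a (encode σ))
encode-injective (a ∷ σ) (b ∷ τ) eq = cong₂ _∷_
  (trans (sym (π₁-pair a (encode σ))) (trans (cong π₁ eq) (π₁-pair b (encode τ))))
  (encode-injective σ τ
    (trans (sym (π₂-pair a (encode σ))) (trans (cong π₂ eq) (π₂-pair b (encode τ)))))

-- `decode` counts up with `next` and does not unfold along `σ`; but a right inverse of an injective
-- function is also a left inverse.
decode-encode : ∀ σ → decode (encode σ) ≡ σ
decode-encode σ = encode-injective _ σ (encode-decode (encode σ))

code-encode : ∀ σ → code (list nat) σ ≡ encode σ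
code-encode []      = refl
code-encode (a ∷ σ) = cong (pair a) (code-encode σ)

-- A number already is the code of the list that it decodes to, hence the identity tracks `decode`.
decodeᶜ : ∀ {F} → Computable Γ nat F → Computable Γ (list nat) (λ γ → decode (F γ))
decodeᶜ = lift₁ decode id-recursive
  λ n → sym (trans (code-encode (decode n)) (encode-decode n))

-- `applyUpTo` recurs with a shifted function, which does not fit primitive recursion on the length.
-- `applyDownFrom` does fit, and a fold reverses its result.
applyUpToᶜ : ∀ {F : El Γ × ℕ → El A} {N} → Computable (Γ ⊗ nat) A F → Computable Γ nat N →
             Computable Γ (list A) (λ γ → applyUpTo (λ i → F (γ , i)) (N γ))
applyUpToᶜ {F = F} {N} f n = computable-ext
  (λ γ → reverse-applyDownFrom (λ i → F (γ , i)) (N γ))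
  (foldlᶜ (sndᶜ (sndᶜ varᶜ) ∷ᶜ fstᶜ (sndᶜ varᶜ)) nilᶜ
    (primᶜ (λ γ → applyDownFrom λ i → F (γ , i)) nilᶜ
      (f ∘ᶜ (fstᶜ varᶜ ,ᶜ fstᶜ (sndᶜ varᶜ)) ∷ᶜ sndᶜ (sndᶜ varᶜ))
      (λ _ → refl) (λ _ _ → refl) n))

-- Machines with finite oracles

approx : Type
approx = list (option nat)

-- A table of initial values, with gaps, of a sequence.
Approx : Set
Approx = El approx

look : Approx → ℕ → Maybe ℕ
look []      i       = nothing
look (v ∷ l) zero    = v
look (v ∷ l) (suc i) = look l i

behead : ∀ {A : Set} → List A → List A
behead []      = []
behead (_ ∷ l) = l

beheadᶜ : ∀ {F} → Computable Γ (list A) F → Computable Γ (list A) (λ γ → behead (F γ))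
beheadᶜ = listrecᶜ (λ _ → behead) nilᶜ (fstᶜ (sndᶜ (sndᶜ varᶜ))) (λ _ → refl) (λ _ _ _ → refl)

beheaded : ∀ {A : Set} → List A → ℕ → List A
beheaded l zero    = l
beheaded l (suc k) = behead (beheaded l k)

-- `look` recurs on table and index together, while `listrecᶜ` keeps its parameters fixed. So the
-- table is beheaded as often as the index says and its first entry is read.
lookᶜ : ∀ {L I} → Computable Γ approx L → Computable Γ nat I →
        Computable Γ (option nat) (λ γ → look (L γ) (I γ))
lookᶜ {Γ} {L} {I} l i = computable-ext (λ γ → first-beheaded (L γ) (I γ))
  (listrecᶜ (λ _ → first) nothingᶜ (fstᶜ (sndᶜ varᶜ)) (λ _ → refl) (λ _ _ _ → refl)
    (primᶜ (λ γ → beheaded (L γ)) l (beheadᶜ (sndᶜ (sndᶜ varᶜ))) (λ _ → refl) (λ _ _ → refl) i))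
  where
  first : Approx → Maybe ℕ
  first []      = nothing
  first (v ∷ _) = v

  beheaded-∷ : ∀ v (l : Approx) i → beheaded (v ∷ l) (suc i) ≡ beheaded l i
  beheaded-∷ v l zero    = refl
  beheaded-∷ v l (suc i) = cong behead (beheaded-∷ v l i)

  beheaded-[] : ∀ i → beheaded {Maybe ℕ} [] i ≡ []
  beheaded-[] zero    = refl
  beheaded-[] (suc i) = cong behead (beheaded-[] i)

  first-beheaded : ∀ l i → first (beheaded l i) ≡ look l i
  first-beheaded []      i       = cong first (beheaded-[] i)
  first-beheaded (v ∷ l) zero    = refl
  first-beheaded (v ∷ l) (suc i) = trans (cong first (beheaded-∷ v l i)) (first-beheaded l i)

scanᶜ : ∀ {F} → Computable Γ (list bool) F → Computable Γ bool (λ γ → scan (F γ))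
scanᶜ = listrecᶜ (λ _ → scan) (constᶜ false) (fstᶜ (sndᶜ varᶜ)) (λ _ → refl) (λ _ _ _ → refl)

beyondᶜ : ∀ {F} → Computable Γ (list bool) F → Computable Γ (list bool) (λ γ → beyond (F γ))
beyondᶜ = listrecᶜ (λ _ → beyond) nilᶜ (fstᶜ (sndᶜ (sndᶜ varᶜ))) (λ _ → refl) (λ _ _ _ → refl)

blockᶜ : ∀ {F} → Computable Γ (list bool) F → Computable Γ nat (λ γ → block (F γ))
blockᶜ = listrecᶜ (λ _ → block) (constᶜ 0)
  (ifᶜ (fstᶜ (sndᶜ varᶜ)) (sucᶜ (sndᶜ (sndᶜ (sndᶜ varᶜ)))) (constᶜ 0))
  (λ _ → refl) λ { _ true _ → refl ; _ false _ → refl }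

unblockᶜ : ∀ {F} → Computable Γ (list bool) F →
           Computable Γ (list bool) (λ γ → dropWhileᵇ id (F γ))
unblockᶜ = listrecᶜ (λ _ → dropWhileᵇ id) nilᶜ
  (ifᶜ b (sndᶜ (sndᶜ (sndᶜ varᶜ))) (b ∷ᶜ fstᶜ (sndᶜ (sndᶜ varᶜ))))
  (λ _ → refl) λ { _ true _ → refl ; _ false _ → refl }
  where
  b : Computable (A ⊗ B ⊗ C) B _
  b = fstᶜ (sndᶜ varᶜ)

replicateᶜ : ∀ {N L} → Computable Γ nat N → Computable Γ (list bool) L →
             Computable Γ (list bool) (λ γ → replicate (N γ) true ++ L γ)
replicateᶜ {L = L} n l = primᶜ (λ γ k → replicate k true ++ L γ) l
  (constᶜ true ∷ᶜ sndᶜ (sndᶜ varᶜ)) (λ _ → refl) (λ _ _ → refl) n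

-- Like `perform`, but undefined when the table of the oracle is too short.
performᵃ : Vec Approx q → Action q → ℕ → List Bool → List Bool → Maybe Config
performᵃ ls (print b) s l r = just (config s l (b ∷ beyond r))
performᵃ ls left      s l r = just (config s (beyond l) (scan l ∷ r))
performᵃ ls right     s l r = just (config s (scan r ∷ l) (beyond r))
performᵃ ls (query j) s l r =
  look (lookup ls j) (block r) >>= λ k → just (config s l (replicate k true ++ dropWhileᵇ id r))

performᵃᶜ : ∀ {q I} {LS : El Γ → Vec Approx q} {S L R} →
            Computable Γ (fin (4 + q)) I → Computable Γ (vec approx q) LS →
            Computable Γ nat S → Computable Γ (list bool) L → Computable Γ (list bool) R →
            Computable Γ (option config)
              (λ γ → performᵃ (LS γ) (toAction (I γ)) (S γ) (L γ) (R γ))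
performᵃᶜ {Γ} {q} {LS = LS} {S} {L} {R} i ls s l r = caseFinᶜ
  {F = λ i γ → performᵃ (LS γ) (toAction i) (S γ) (L γ) (R γ)} by-action i
  where
  by-action : ∀ i → Computable Γ (option config)
                      (λ γ → performᵃ (LS γ) (toAction i) (S γ) (L γ) (R γ))
  by-action 0F = justᶜ (configᶜ s l (constᶜ false ∷ᶜ beyondᶜ r))
  by-action 1F = justᶜ (configᶜ s l (constᶜ true ∷ᶜ beyondᶜ r))
  by-action 2F = justᶜ (configᶜ s (beyondᶜ l) (scanᶜ l ∷ᶜ r))
  by-action 3F = justᶜ (configᶜ s (scanᶜ r ∷ᶜ l) (beyondᶜ r))
  by-action (suc (suc (suc (suc j)))) =
    lookᶜ (lookupᶜ j ls) (blockᶜ r) >>=ᶜ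
    justᶜ (configᶜ (weaken s) (weaken l)
      (replicateᶜ (sndᶜ varᶜ) (unblockᶜ (weaken r))))

-- The action and the new state of the first applicable quadruple, still as numbers.
instruction : List ℕ → ℕ → Bool → Maybe (ℕ × ℕ)
instruction (s ∷ b ∷ a ∷ s′ ∷ σ) t c =
  if (s ≡ᵇ t) ∧ does (toSymbol b ≟ᵇ c) then just (a , s′) else instruction σ t c
instruction _ t c = nothing

≟ᵇᶜ : ∀ {F G} → Computable Γ bool F → Computable Γ bool G →
      Computable Γ bool (λ γ → does (F γ ≟ᵇ G γ))
≟ᵇᶜ {F = F} {G} b c = computable-ext (λ γ → compare (F γ) (G γ))
  (ifᶜ b c (ifᶜ c (constᶜ false) (constᶜ true)))
  where
  compare : ∀ b c → (if b then c else (if c then false else true)) ≡ does (b ≟ᵇ c)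
  compare false false = refl
  compare false true  = refl
  compare true  false = refl
  compare true  true  = refl

toSymbolᶜ : ∀ {F} → Computable Γ nat F → Computable Γ bool (λ γ → toSymbol (F γ))
toSymbolᶜ = caseNatᶜ (λ _ → toSymbol) (constᶜ false) (constᶜ true) (λ _ → refl) (λ _ _ → refl)

headOr0 : List ℕ → ℕ
headOr0 []      = 0
headOr0 (a ∷ _) = a

headOr0ᶜ : ∀ {F} → Computable Γ (list nat) F → Computable Γ nat (λ γ → headOr0 (F γ))
headOr0ᶜ = listrecᶜ (λ _ → headOr0) (constᶜ 0) (fstᶜ (sndᶜ varᶜ)) (λ _ → refl) (λ _ _ _ → refl)

null : ∀ {A : Set} → List A → Bool
null []      = true
null (_ ∷ _) = false

nullᶜ : ∀ {F} → Computable Γ (list A) F → Computable Γ bool (λ γ → null (F γ))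
nullᶜ = listrecᶜ (λ _ → null) (constᶜ true) (constᶜ false) (λ _ → refl) (λ _ _ _ → refl)

-- `instruction` recurs on the fourth tail of its argument, hence its values
-- at the first three tails are carried along.
instructionᶜ : ∀ {F T C} → Computable Γ (list nat) F → Computable Γ nat T → Computable Γ bool C →
               Computable Γ (option (nat ⊗ nat)) (λ γ → instruction (F γ) (T γ) (C γ))
instructionᶜ {Γ} {F} {T} {C} σ t c = fstᶜ (listrecᶜ instructions
    (nothingᶜ ,ᶜ nothingᶜ ,ᶜ nothingᶜ ,ᶜ nothingᶜ)
    (instruction₄ ,ᶜ fstᶜ i ,ᶜ fstᶜ (sndᶜ i) ,ᶜ fstᶜ (sndᶜ (sndᶜ i)))
    (λ _ → refl)
    (λ { γ s [] → refl ; γ s (b ∷ []) → refl ; γ s (b ∷ a ∷ []) → refl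
       ; γ s (b ∷ a ∷ s′ ∷ σ) → refl })
    σ)
  where
  instructions : El Γ → List ℕ → _
  instructions γ σ =
    instruction σ (T γ) (C γ) , instruction (behead σ) (T γ) (C γ) ,
    instruction (behead (behead σ)) (T γ) (C γ) ,
    instruction (behead (behead (behead σ))) (T γ) (C γ)

  Δ = Γ ⊗ nat ⊗ list nat ⊗
      option (nat ⊗ nat) ⊗ option (nat ⊗ nat) ⊗ option (nat ⊗ nat) ⊗ option (nat ⊗ nat)

  s : Computable Δ nat _
  s = fstᶜ (sndᶜ varᶜ)

  τ : Computable Δ (list nat) _
  τ = fstᶜ (sndᶜ (sndᶜ varᶜ))

  i : Computable Δ _ _
  i = sndᶜ (sndᶜ (sndᶜ varᶜ))

  instruction₄ : Computable Δ (option (nat ⊗ nat)) _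
  -- `τ` lacks the first entry `s`, so the quadruple is complete when `τ` has at least three
  -- entries. The last component of `i` belongs to what follows the quadruple.
  instruction₄ = ifᶜ (nullᶜ (beheadᶜ (beheadᶜ τ))) nothingᶜ
    (ifᶜ (∧ᶜ (≡ᵇᶜ s (weaken t)) (≟ᵇᶜ (toSymbolᶜ (headOr0ᶜ τ)) (weaken c)))
      (justᶜ (headOr0ᶜ (beheadᶜ τ) ,ᶜ headOr0ᶜ (beheadᶜ (beheadᶜ τ))))
      (sndᶜ (sndᶜ (sndᶜ i))))

-- Halted configurations are fixed; nothing means that an oracle value is missing.
advance : List ℕ → Vec Approx q → Config → Maybe Config
advance {q} σ ls c@(config t l r) =
  maybe (λ (a , s) → performᵃ ls (toAction (a mod (4 + q))) s l r) (just c)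
    (instruction σ t (scan r))

runs : List ℕ → Vec Approx q → ℕ → Config → Maybe Config
runs σ ls zero    c = just c
runs σ ls (suc n) c = runs σ ls n c >>= advance σ ls

output : List ℕ → Config → Maybe ℕ
output σ (config t l r) = maybe (λ _ → nothing) (just (block r)) (instruction σ t (scan r))

simulate : List ℕ → Vec Approx q → ℕ → Config → Maybe ℕ
simulate σ ls n c = runs σ ls n c >>= output σ

advanceᶜ : Computable (list nat ⊗ vec approx q ⊗ config) (option config)
             (λ (σ , ls , c) → advance σ ls c)
advanceᶜ = maybeᶜ (instructionᶜ σ (fstᶜ c) (scanᶜ (sndᶜ (sndᶜ c))))
  (performᵃᶜ (modᶜ (fstᶜ (sndᶜ varᶜ))) (weaken ls) (sndᶜ (sndᶜ varᶜ))
    (weaken (fstᶜ (sndᶜ c))) (weaken (sndᶜ (sndᶜ c))))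
  (justᶜ (sndᶜ (sndᶜ varᶜ)))
  where
  σ : Computable (A ⊗ B) A _
  σ = fstᶜ varᶜ

  ls : Computable (A ⊗ B ⊗ C) B _
  ls = fstᶜ (sndᶜ varᶜ)

  c : Computable (A ⊗ B ⊗ config) _ _
  c = fieldsᶜ (sndᶜ (sndᶜ varᶜ))

outputᶜ : Computable (list nat ⊗ config) (option nat) (λ (σ , c) → output σ c)
outputᶜ = maybeᶜ (instructionᶜ (fstᶜ varᶜ) (fstᶜ c) (scanᶜ (sndᶜ (sndᶜ c))))
  nothingᶜ (justᶜ (blockᶜ (sndᶜ (sndᶜ c))))
  where
  c : Computable (A ⊗ config) _ _
  c = fieldsᶜ (sndᶜ varᶜ)

simulateᶜ : ∀ {Q N C} {LS : El Γ → Vec Approx q} → Computable Γ (list nat) Q →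
            Computable Γ (vec approx q) LS → Computable Γ nat N → Computable Γ config C →
            Computable Γ (option nat) (λ γ → simulate (Q γ) (LS γ) (N γ) (C γ))
simulateᶜ {Q = Q} {N} {C} {LS} σ ls n c =
  primᶜ (λ γ k → runs (Q γ) (LS γ) k (C γ)) (justᶜ c)
    (sndᶜ (sndᶜ varᶜ) >>=ᶜ advanceᶜ ∘ᶜ (weaken (weaken σ) ,ᶜ weaken (weaken ls) ,ᶜ sndᶜ varᶜ))
    (λ _ → refl) (λ _ _ → refl) n
  >>=ᶜ outputᶜ ∘ᶜ (weaken σ ,ᶜ sndᶜ varᶜ)

-- The part of Ψ(e; -) that is computed in s steps from the tables ls.
tabulate : ℕ → Vec Approx q → ℕ → Approx
tabulate e ls s = applyUpTo (λ i → simulate (decode e) ls s (initial i)) s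

tabulateᶜ : ∀ {E S} {LS : El Γ → Vec Approx q} → Computable Γ nat E →
            Computable Γ (vec approx q) LS → Computable Γ nat S →
            Computable Γ approx (λ γ → tabulate (E γ) (LS γ) (S γ))
tabulateᶜ e ls s = applyUpToᶜ
  (simulateᶜ (decodeᶜ (weaken e)) (weaken ls) (weaken s)
    (configᶜ (constᶜ 0) nilᶜ
      (computable-ext (λ _ → ++-identityʳ _) (replicateᶜ (sndᶜ varᶜ) nilᶜ))))
  s

-- Evaluation along guesses

private variable
  c : Codomain

val : Codomain → Type
val num = nat
val seq = approx

vanishes : Maybe ℕ → Bool
vanishes = maybe isZero false

nonzero : Maybe ℕ → Bool
nonzero = maybe (λ v → if isZero v then false else true) false

hasNonzero : Approx → Bool
hasNonzero []      = false
hasNonzero (v ∷ l) = if nonzero v then true else hasNonzero l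

-- A guess 0 claims that the sequence is zero, a guess suc i that its entry i
-- is nonzero; the result is nothing if the table refutes the claim.
answer : Approx → ℕ → Maybe ℕ
answer l zero    = if hasNonzero l then nothing else just 1
answer l (suc i) = if vanishes (look l i) then nothing else just 0

recM : Maybe X → (ℕ → X → Maybe X) → ℕ → Maybe X
recM z s zero    = z
recM z s (suc k) = recM z s k >>= s k

ev : PR p q c → ℕ → Vec ℕ p → Vec Approx q → ℕ → Maybe (El (val c) × ℕ)
evs : Vec (PR p q c) m → ℕ → Vec ℕ p → Vec Approx q → ℕ → Maybe (Vec (El (val c)) m × ℕ)
search : PR (suc p) q num → ℕ → Vec ℕ p → Vec Approx q → ℕ → ℕ → Maybe ℕ

-- Evaluation at stage s, on tables ls for the sequence arguments.  The answers
-- of χ and the values of μ are guessed, by popping components off the number g;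
-- the remaining guesses are returned, or nothing if a guess is refuted.
ev zero           s ns ls g = just (0 , g)
ev succ           s ns ls g = just (suc (head ns) , g)
ev (projₙ i)      s ns ls g = just (lookup ns i , g)
ev (projₛ j)      s ns ls g = just (lookup ls j , g)
ev (Ψ q)          s ns ls g = just (tabulate (head ns) ls s , g)
ev χ              s ns ls g = answer (head ls) (π₁ g) >>= λ v → just (v , π₂ g)
ev (comp f gs hs) s ns ls g =
  evs gs s ns ls g >>= λ (ns′ , g) → evs hs s ns ls g >>= λ (ls′ , g) → ev f s ns′ ls′ g
ev (primₙ G H)    s ns ls g =
  recM (ev G s (tail ns) ls g) (λ k (u , g) → ev H s (k ∷ (tail ns ∷ʳ u)) ls g) (head ns)
ev (primₛ G H)    s ns ls g =
  recM (ev G s (tail ns) ls g) (λ k (u , g) → ev H s (k ∷ tail ns) (ls ∷ʳ u) g) (head ns)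
ev (μ G)          s ns ls g =
  search G s ns ls (π₂ g) (π₁ g) >>= λ g′ → ev G s (π₁ g ∷ ns) ls g′ >>= λ (v , g″) →
  if isZero v then just (π₁ g , g″) else nothing

evs []       s ns ls g = just ([] , g)
evs (f ∷ fs) s ns ls g =
  ev f s ns ls g >>= λ (v , g) → evs fs s ns ls g >>= λ (vs , g) → just (v ∷ vs , g)

search G s ns ls g = recM (just g) λ k g → ev G s (k ∷ ns) ls g >>= λ (v , g) →
  if isZero v then nothing else just g

-- Computability of the evaluation along guesses.

hasNonzeroᶜ : ∀ {L} → Computable Γ approx L → Computable Γ bool (λ γ → hasNonzero (L γ))
hasNonzeroᶜ = listrecᶜ (λ _ → hasNonzero) (constᶜ false)
  (ifᶜ (maybeᶜ (fstᶜ (sndᶜ varᶜ))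
      (ifᶜ (isZeroᶜ (sndᶜ varᶜ)) (constᶜ false) (constᶜ true)) (constᶜ false))
    (constᶜ true) (sndᶜ (sndᶜ (sndᶜ varᶜ))))
  (λ _ → refl) (λ _ _ _ → refl)

answerᶜ : ∀ {L G} → Computable Γ approx L → Computable Γ nat G →
          Computable Γ (option nat) (λ γ → answer (L γ) (G γ))
answerᶜ {L = L} l = caseNatᶜ (λ γ → answer (L γ))
  (ifᶜ (hasNonzeroᶜ l) nothingᶜ (justᶜ (constᶜ 1)))
  (ifᶜ (maybeᶜ (lookᶜ (weaken l) (sndᶜ varᶜ)) (isZeroᶜ (sndᶜ varᶜ)) (constᶜ false))
    nothingᶜ (justᶜ (constᶜ 0)))
  (λ _ → refl) (λ _ _ → refl)

recMᶜ : ∀ {Z N} {S : El Γ × ℕ × El A → Maybe (El A)} →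
        Computable Γ (option A) Z → Computable (Γ ⊗ nat ⊗ A) (option A) S → Computable Γ nat N →
        Computable Γ (option A) (λ γ → recM (Z γ) (λ k a → S (γ , k , a)) (N γ))
recMᶜ {Z = Z} {S = S} z s = primᶜ (λ γ → recM (Z γ) (λ k a → S (γ , k , a))) z
  (sndᶜ (sndᶜ varᶜ) >>=ᶜ s ∘ᶜ (fstᶜ (fstᶜ varᶜ) ,ᶜ fstᶜ (sndᶜ (fstᶜ varᶜ)) ,ᶜ sndᶜ varᶜ))
  (λ _ → refl) (λ _ _ → refl)

π₁ᶜ : ∀ {F} → Computable Γ nat F → Computable Γ nat (λ γ → π₁ (F γ))
π₁ᶜ = lift₁ π₁ π₁ᴿ λ _ → refl

π₂ᶜ : ∀ {F} → Computable Γ nat F → Computable Γ nat (λ γ → π₂ (F γ))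
π₂ᶜ = lift₁ π₂ π₂ᴿ λ _ → refl

-- The recursion on `f` takes place outside the coded functions: each fixed `f` yields its own
-- tracker, so terms of `PR` are never coded.
evᶜ : (f : PR p q c) → ∀ {S NS G} {LS : El Γ → Vec Approx q} → Computable Γ nat S →
      Computable Γ (vec nat p) NS → Computable Γ (vec approx q) LS → Computable Γ nat G →
      Computable Γ (option (val c ⊗ nat)) (λ γ → ev f (S γ) (NS γ) (LS γ) (G γ))
evsᶜ : (fs : Vec (PR p q c) m) → ∀ {S NS G} {LS : El Γ → Vec Approx q} → Computable Γ nat S →
       Computable Γ (vec nat p) NS → Computable Γ (vec approx q) LS → Computable Γ nat G →
       Computable Γ (option (vec (val c) m ⊗ nat)) (λ γ → evs fs (S γ) (NS γ) (LS γ) (G γ))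
searchᶜ : (f : PR (suc p) q num) → ∀ {S NS G K} {LS : El Γ → Vec Approx q} → Computable Γ nat S →
          Computable Γ (vec nat p) NS → Computable Γ (vec approx q) LS → Computable Γ nat G →
          Computable Γ nat K →
          Computable Γ (option nat) (λ γ → search f (S γ) (NS γ) (LS γ) (G γ) (K γ))

evᶜ zero      s ns ls g = justᶜ (constᶜ 0 ,ᶜ g)
evᶜ succ      s ns ls g = justᶜ (sucᶜ (headᶜ ns) ,ᶜ g)
evᶜ (projₙ i) s ns ls g = justᶜ (lookupᶜ i ns ,ᶜ g)
evᶜ (projₛ j) s ns ls g = justᶜ (lookupᶜ j ls ,ᶜ g)
evᶜ (Ψ q)     s ns ls g = justᶜ (tabulateᶜ (headᶜ ns) ls s ,ᶜ g)
evᶜ χ         s ns ls g =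
  answerᶜ (headᶜ ls) (π₁ᶜ g) >>=ᶜ justᶜ (sndᶜ varᶜ ,ᶜ weaken (π₂ᶜ g))
evᶜ (comp f gs hs) s ns ls g =
  evsᶜ gs s ns ls g >>=ᶜ
  (evsᶜ hs (weaken s) (weaken ns) (weaken ls) (sndᶜ (sndᶜ varᶜ)) >>=ᶜ
  evᶜ f (weaken (weaken s)) (fstᶜ (sndᶜ (fstᶜ varᶜ))) (fstᶜ (sndᶜ varᶜ)) (sndᶜ (sndᶜ varᶜ)))
evᶜ (primₙ G H) s ns ls g = recMᶜ (evᶜ G s (tailᶜ ns) ls g)
  (evᶜ H (weaken s) (fstᶜ (sndᶜ varᶜ) ∷ᵛ ∷ʳᶜ (weaken (tailᶜ ns)) (fstᶜ (sndᶜ (sndᶜ varᶜ))))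
    (weaken ls) (sndᶜ (sndᶜ (sndᶜ varᶜ))))
  (headᶜ ns)
evᶜ (primₛ G H) s ns ls g = recMᶜ (evᶜ G s (tailᶜ ns) ls g)
  (evᶜ H (weaken s) (fstᶜ (sndᶜ varᶜ) ∷ᵛ weaken (tailᶜ ns))
    (∷ʳᶜ (weaken ls) (fstᶜ (sndᶜ (sndᶜ varᶜ)))) (sndᶜ (sndᶜ (sndᶜ varᶜ))))
  (headᶜ ns)
evᶜ (μ G) s ns ls g =
  searchᶜ G s ns ls (π₂ᶜ g) (π₁ᶜ g) >>=ᶜ
  (evᶜ G (weaken s) (weaken (π₁ᶜ g) ∷ᵛ weaken ns) (weaken ls) (sndᶜ varᶜ) >>=ᶜ
  ifᶜ (isZeroᶜ (fstᶜ (sndᶜ varᶜ))) (justᶜ (weaken (weaken (π₁ᶜ g)) ,ᶜ sndᶜ (sndᶜ varᶜ))) nothingᶜ)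

evsᶜ []       s ns ls g = justᶜ (vnilᶜ ,ᶜ g)
evsᶜ (f ∷ fs) s ns ls g =
  evᶜ f s ns ls g >>=ᶜ
  (evsᶜ fs (weaken s) (weaken ns) (weaken ls) (sndᶜ (sndᶜ varᶜ)) >>=ᶜ
  justᶜ (fstᶜ (sndᶜ (fstᶜ varᶜ)) ∷ᵛ fstᶜ (sndᶜ varᶜ) ,ᶜ sndᶜ (sndᶜ varᶜ)))

searchᶜ G s ns ls g k = recMᶜ (justᶜ g)
  (evᶜ G (weaken s) (fstᶜ (sndᶜ varᶜ) ∷ᵛ weaken ns) (weaken ls) (sndᶜ (sndᶜ varᶜ)) >>=ᶜ
   ifᶜ (isZeroᶜ (fstᶜ (sndᶜ varᶜ))) nothingᶜ (justᶜ (sndᶜ (sndᶜ varᶜ))))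
  k

-- Correctness of the machine simulation

_⊑_ : Approx → 𝒩 → Set
l ⊑ x = ∀ i {v} → look l i ≡ just v → x i ≡ v

look-applyUpTo : ∀ (f : ℕ → Maybe ℕ) {s i} → i < s → look (applyUpTo f s) i ≡ f i
look-applyUpTo f {suc s} {zero}  _         = refl
look-applyUpTo f {suc s} {suc i} (s≤s i<s) = look-applyUpTo (f ∘ suc) i<s

look-applyUpTo⁻ : ∀ (f : ℕ → Maybe ℕ) s i {v} → look (applyUpTo f s) i ≡ just v → f i ≡ just v
look-applyUpTo⁻ f (suc s) zero    eq = eq
look-applyUpTo⁻ f (suc s) (suc i) eq = look-applyUpTo⁻ (f ∘ suc) s i eq

-- Splits a step into the choice of the quadruple, which the true run and the simulation share, and
-- its execution, where alone the oracles enter.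
step-instruction : ∀ {q} σ (xs : Vec 𝒩 q) t l r →
  step (toMachine σ) xs (config t l r) ≡
  Maybe.map (λ (a , s) → perform xs (toAction (a mod (4 + q))) s l r) (instruction σ t (scan r))
step-instruction []              xs t l r = refl
step-instruction (_ ∷ [])        xs t l r = refl
step-instruction (_ ∷ _ ∷ [])    xs t l r = refl
step-instruction (_ ∷ _ ∷ _ ∷ []) xs t l r = refl
step-instruction (s ∷ b ∷ a ∷ s′ ∷ σ) xs t l r
  with (s ≡ᵇ t) ∧ does (toSymbol b ≟ᵇ scan r)
... | true  = refl
... | false = step-instruction σ xs t l r

module _ {ls : Vec Approx q} {xs : Vec 𝒩 q} (ls⊑xs : Pointwise _⊑_ ls xs) where

  performᵃ-sound : ∀ a s l r {c} → performᵃ ls a s l r ≡ just c → c ≡ perform xs a s l r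
  performᵃ-sound (print b) s l r refl = refl
  performᵃ-sound left      s l r refl = refl
  performᵃ-sound right     s l r refl = refl
  performᵃ-sound (query j) s l r eq
    with look (lookup ls j) (block r) in value
  performᵃ-sound (query j) s l r refl | just k
    rewrite Pointwise.lookup ls⊑xs j (block r) value = refl

  -- Goes from the later configuration back to the earlier one, because a `Result` is built up from
  -- its halting end. A halted configuration was left in place and contributes no move.
  advance-sound : ∀ σ c {c′ k} → advance σ ls c ≡ just c′ →
                  Result (toMachine σ) xs c′ k → Result (toMachine σ) xs c k
  advance-sound σ (config t l r) eq res
    with instruction σ t (scan r) | step-instruction σ xs t l r
  advance-sound σ (config t l r) refl res | nothing      | _     = res
  ... | just (a , s) | steps =
    move (trans steps (cong just (sym (performᵃ-sound _ s l r eq)))) res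

  runs-sound : ∀ σ n c {c′ k} → runs σ ls n c ≡ just c′ →
               Result (toMachine σ) xs c′ k → Result (toMachine σ) xs c k
  runs-sound σ zero    c refl res = res
  runs-sound σ (suc n) c eq   res with runs σ ls n c in runs-n
  ... | just c″ = runs-sound σ n c runs-n (advance-sound σ c″ eq res)

  output-sound : ∀ σ c {k} → output σ c ≡ just k → Result (toMachine σ) xs c k
  output-sound σ (config t l r) eq
    with instruction σ t (scan r) | step-instruction σ xs t l r
  output-sound σ (config t l r) refl | nothing | halts = halt halts

  simulate-sound : ∀ σ n c {k} → simulate σ ls n c ≡ just k → Result (toMachine σ) xs c k
  simulate-sound σ n c eq with runs σ ls n c in runs-n
  ... | just c′ = runs-sound σ n c runs-n (output-sound σ c′ eq)

Result-deterministic : ∀ {M : Machine q} {xs c k k′} →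
                       Result M xs c k → Result M xs c k′ → k ≡ k′
Result-deterministic (halt _)   (halt _)    = refl
Result-deterministic (halt h)   (move m _)  with () ← trans (sym h) m
Result-deterministic (move m _) (halt h)    with () ← trans (sym h) m
Result-deterministic (move m r) (move m′ r′) with refl ← trans (sym m) m′ =
  Result-deterministic r r′

tabulate-sound : ∀ {e} {ls : Vec Approx q} {xs y} → (∀ i → Φ xs e i (y i)) →
                 Pointwise _⊑_ ls xs → ∀ s → tabulate e ls s ⊑ y
tabulate-sound {e = e} Φy ls⊑xs s i eq = Result-deterministic (Φy i)
  (simulate-sound ls⊑xs (decode e) s (initial i) (look-applyUpTo⁻ _ s i eq))

-- Convergence of tables and completeness of the simulation.

Eventually : (ℕ → Set) → Set
Eventually P = ∃[ S ] ∀ s → S ≤ s → P s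

always : ∀ {P} → (∀ s → P s) → Eventually P
always p = 0 , λ s _ → p s

both : ∀ {P Q R} → (∀ s → P s → Q s → R s) → Eventually P → Eventually Q → Eventually R
both f (S , p) (T , q) = S ⊔ T , λ s S⊔T≤s →
  f s (p s (≤-trans (m≤m⊔n S T) S⊔T≤s)) (q s (≤-trans (m≤n⊔m S T) S⊔T≤s))

eventually : ∀ {P Q} → (∀ s → P s → Q s) → Eventually P → Eventually Q
eventually f (S , p) = S , λ s S≤s → f s (p s S≤s)

-- By the first half, correct answers of `χ` survive at every stage; by the second, false ones are
-- refuted from some stage on.
_⇝_ : (ℕ → Approx) → 𝒩 → Set
L ⇝ x = (∀ s → L s ⊑ x) × (∀ i → Eventually λ s → look (L s) i ≡ just (x i))

stage : Vec (ℕ → X) n → ℕ → Vec X n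
stage Ls s = Vec.map (_$ s) Ls

stage-⊑ : ∀ {Ls : Vec (ℕ → Approx) q} {xs : Vec 𝒩 q} → Pointwise _⇝_ Ls xs →
          ∀ s → Pointwise _⊑_ (stage Ls s) xs
stage-⊑ []            s = []
stage-⊑ ((l⊑x , _) ∷ Ls⇝xs) s = l⊑x s ∷ stage-⊑ Ls⇝xs s

advance-nothing : ∀ σ (ls : Vec Approx q) t l r → instruction σ t (scan r) ≡ nothing →
                  advance σ ls (config t l r) ≡ just (config t l r)
advance-nothing σ ls t l r eq rewrite eq = refl

advance-just : ∀ σ (ls : Vec Approx q) t l r {a s} → instruction σ t (scan r) ≡ just (a , s) →
               advance σ ls (config t l r) ≡ performᵃ ls (toAction (a mod (4 + q))) s l r
advance-just σ ls t l r eq rewrite eq = refl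

output-nothing : ∀ σ t l r → instruction σ t (scan r) ≡ nothing →
                 output σ (config t l r) ≡ just (block r)
output-nothing σ t l r eq rewrite eq = refl

runs-fixed : ∀ σ {ls : Vec Approx q} {c} → advance σ ls c ≡ just c → ∀ n → runs σ ls n c ≡ just c
runs-fixed σ fixed zero    = refl
runs-fixed σ fixed (suc n) rewrite runs-fixed σ fixed n = fixed

runs-suc : ∀ σ (ls : Vec Approx q) n {c c′} → advance σ ls c ≡ just c′ →
           runs σ ls (suc n) c ≡ runs σ ls n c′
runs-suc σ ls zero    eq = eq
runs-suc σ ls (suc n) eq = cong (_>>= advance σ ls) (runs-suc σ ls n eq)

module _ {Ls : Vec (ℕ → Approx) q} {xs : Vec 𝒩 q} (Ls⇝xs : Pointwise _⇝_ Ls xs) where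

  performᵃ-complete : ∀ a t l r →
    Eventually λ s → performᵃ (stage Ls s) a t l r ≡ just (perform xs a t l r)
  performᵃ-complete (print b) t l r = always λ _ → refl
  performᵃ-complete left      t l r = always λ _ → refl
  performᵃ-complete right     t l r = always λ _ → refl
  performᵃ-complete (query j) t l r =
    eventually known (proj₂ (Pointwise.lookup Ls⇝xs j) (block r))
    where
    known : ∀ s → look (lookup Ls j s) (block r) ≡ just (lookup xs j (block r)) →
            performᵃ (stage Ls s) (query j) t l r ≡ just (perform xs (query j) t l r)
    known s eq = cong (_>>= λ k → just (config t l (replicate k true ++ dropWhileᵇ id r)))
      (trans (cong (λ l → look l (block r)) (lookup-map j (_$ s) Ls)) eq)

  -- The stage `s` of the tables and the number `n` of steps are separate, because the induction
  -- uses up a step while the tables stay those of stage `s`.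
  simulate-complete : ∀ σ {c k} → Result (toMachine σ) xs c k →
    ∃[ N ] ∀ s n → N ≤ s → N ≤ n → simulate σ (stage Ls s) n c ≡ just k
  simulate-complete σ {config t l r} (halt halts)
    with instruction σ t (scan r) in instr | step-instruction σ xs t l r
  ... | just _  | steps with () ← trans (sym halts) steps
  ... | nothing | _     = 0 , λ s n _ _ →
    trans (cong (_>>= output σ) (runs-fixed σ (advance-nothing σ (stage Ls s) t l r instr) n))
      (output-nothing σ t l r instr)
  simulate-complete σ {config t l r} (move {c′ = c′} moves res)
    with instruction σ t (scan r) in instr | step-instruction σ xs t l r
  ... | nothing      | steps with () ← trans (sym moves) steps
  ... | just (a , t′) | steps with refl ← trans (sym steps) moves = 
    let N₁ , p = performᵃ-complete (toAction (a mod (4 + q))) t′ l r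
        N₂ , h = simulate-complete σ res
    in suc (N₁ ⊔ N₂) , λ where
      s (suc n) N<s (s≤s N≤n) → trans
        (cong (_>>= output σ) (runs-suc σ (stage Ls s) n
          (trans (advance-just σ (stage Ls s) t l r instr)
            (p s (≤-trans (m≤m⊔n N₁ N₂) (<⇒≤ N<s))))))
        (h s n (≤-trans (m≤n⊔m N₁ N₂) (<⇒≤ N<s)) (≤-trans (m≤n⊔m N₁ N₂) N≤n))

  tabulate-complete : ∀ {e y} → (∀ i → Φ xs e i (y i)) → (λ s → tabulate e (stage Ls s) s) ⇝ y
  tabulate-complete {e} Φy =
    (λ s → tabulate-sound {e = e} Φy (stage-⊑ Ls⇝xs s) s) ,
    λ i → let N , h = simulate-complete (decode e) (Φy i) in
      -- `suc i` makes the table long enough to contain entry `i`; `N` leaves its computation enough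
      -- steps and oracle values.
      suc i ⊔ N , λ s i⊔N≤s →
        trans (look-applyUpTo _ (≤-trans (m≤m⊔n (suc i) N) i⊔N≤s))
          (h s s (≤-trans (m≤n⊔m (suc i) N) i⊔N≤s) (≤-trans (m≤n⊔m (suc i) N) i⊔N≤s))

-- Correct guesses are never refuted

Correct : ∀ c → El (val c) → ⟦ c ⟧ → Set
Correct num = _≡_
Correct seq = _⊑_

hasNonzero-false : ∀ l {x} → (∀ i → x i ≡ 0) → l ⊑ x → hasNonzero l ≡ false
hasNonzero-false []              x≡0 l⊑x = refl
hasNonzero-false (nothing ∷ l)   x≡0 l⊑x = hasNonzero-false l (x≡0 ∘ suc) (l⊑x ∘ suc)
hasNonzero-false (just zero ∷ l) x≡0 l⊑x = hasNonzero-false l (x≡0 ∘ suc) (l⊑x ∘ suc)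
hasNonzero-false (just (suc v) ∷ l) x≡0 l⊑x with () ← trans (sym (x≡0 0)) (l⊑x 0 refl)

hasNonzero-true : ∀ l i {v} → look l i ≡ just (suc v) → hasNonzero l ≡ true
hasNonzero-true (just _ ∷ l)  zero    refl = refl
hasNonzero-true (nothing ∷ l)      (suc i) eq = hasNonzero-true l i eq
hasNonzero-true (just zero ∷ l)    (suc i) eq = hasNonzero-true l i eq
hasNonzero-true (just (suc _) ∷ l) (suc i) eq = refl

vanishes-false : ∀ l i {x} → x i ≢ 0 → l ⊑ x → vanishes (look l i) ≡ false
vanishes-false l i xi≢0 l⊑x with look l i in value
... | nothing      = refl
... | just zero    = contradiction (l⊑x i value) xi≢0
... | just (suc _) = refl

∷ʳ⁺ : ∀ {X Y : Set} {R : X → Y → Set} {xs : Vec X n} {ys : Vec Y n} {x y} →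
      Pointwise R xs ys → R x y → Pointwise R (xs ∷ʳ x) (ys ∷ʳ y)
∷ʳ⁺ []         r = r ∷ []
∷ʳ⁺ (r′ ∷ rs) r = r′ ∷ ∷ʳ⁺ rs r

bind-just : ∀ {a? : Maybe X} {a} {K : X → Maybe Y} {b?} →
            a? ≡ just a → K a ≡ b? → (a? >>= K) ≡ b?
bind-just refl eq = eq

answer-pair : ∀ l a g {v} → answer l a ≡ just v →
              ev χ 0 [] (l ∷ []) (pair a g) ≡ just (v , g)
answer-pair l a g eq = trans
  (cong₂ (λ a g → answer l a >>= λ v → just (v , g)) (π₁-pair a g) (π₂-pair a g))
  (bind-just eq refl)

-- `γ` pushes the correct guesses of this computation in front of an arbitrary remainder `g`, and
-- evaluation pops exactly these; successive computations then correspond to composition, the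
-- earliest outermost. As `γ` is chosen before stage and tables, the same guesses serve all initial
-- segments.
Honest : PR p q c → Vec ℕ p → Vec 𝒩 q → ⟦ c ⟧ → Set
Honest {c = c} f ns xs v =
  Σ[ γ ∈ (ℕ → ℕ) ] ∀ s g {ls} → Pointwise _⊑_ ls xs →
  ∃[ w ] Correct c w v × ev f s ns ls (γ g) ≡ just (w , g)

Honests : Vec (PR p q c) m → Vec ℕ p → Vec 𝒩 q → Vec ⟦ c ⟧ m → Set
Honests {c = c} fs ns xs vs =
  Σ[ γ ∈ (ℕ → ℕ) ] ∀ s g {ls} → Pointwise _⊑_ ls xs →
  ∃[ ws ] Pointwise (Correct c) ws vs × evs fs s ns ls (γ g) ≡ just (ws , g)

search-honest : ∀ (G : PR (suc p) q num) ns {xs} →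
                (∀ {j} → j < k → ∃[ v ] Honest G (j ∷ ns) xs (suc v)) → ∀ j → j ≤ k →
                Σ[ γ ∈ (ℕ → ℕ) ] ∀ s g {ls} → Pointwise _⊑_ ls xs →
                search G s ns ls (γ g) j ≡ just g
search-honest G ns G>0 zero    _   = id , λ _ _ _ → refl
search-honest G ns G>0 (suc j) j<k with search-honest G ns G>0 j (<⇒≤ j<k) | G>0 j<k
... | γ₁ , below | v , γ₂ , at = γ₁ ∘ γ₂ , λ s g ls⊑xs →
  let w , w≡v , eq = at s g ls⊑xs in
  bind-just (below s (γ₂ g) ls⊑xs)
    (bind-just eq (cong (λ w → if isZero w then nothing else just g) w≡v))

honest  : ∀ {f : PR p q c} {ns xs v} → Eval f ns xs v → Honest f ns xs v
honests : ∀ {fs : Vec (PR p q c) m} {ns xs vs} →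
          Pointwise (λ f → Eval f ns xs) fs vs → Honests fs ns xs vs

honest zero      = id , λ _ _ _ → _ , refl , refl
honest succ      = id , λ _ _ _ → _ , refl , refl
honest (projₙ i) = id , λ _ _ _ → _ , refl , refl
honest (projₛ j) = id , λ _ _ ls⊑xs → _ , Pointwise.lookup ls⊑xs j , refl
honest (Ψ {e = e} Φy) = id , λ s _ ls⊑xs → _ , tabulate-sound {e = e} Φy ls⊑xs s , refl
honest (χ-zero x≡0) = pair 0 , λ where
  s g (_∷_ {x = l} l⊑x []) → 1 , refl , answer-pair l 0 g
    (cong (λ b → if b then nothing else just 1) (hasNonzero-false l x≡0 l⊑x))
honest (χ-else (i , xi≢0)) = pair (suc i) , λ where
  s g (_∷_ {x = l} l⊑x []) → 0 , refl , answer-pair l (suc i) g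
    (cong (λ b → if b then nothing else just 0) (vanishes-false l i xi≢0 l⊑x))
honest (comp {f = f} gs hs e) with honests gs | honests hs | honest e
... | γ₁ , p₁ | γ₂ , p₂ | γ₃ , p₃ = γ₁ ∘ γ₂ ∘ γ₃ , λ s g ls⊑xs →
  let ns , ns≡ , eq₁ = p₁ s (γ₂ (γ₃ g)) ls⊑xs
      ls , ls⊑ , eq₂ = p₂ s (γ₃ g) ls⊑xs
      w , w-correct , eq₃ = p₃ s g ls⊑
  in w , w-correct , bind-just eq₁ (bind-just eq₂
       (trans (cong (λ ns → ev f s ns ls (γ₃ g)) (Pointwise-≡⇒≡ ns≡)) eq₃))
honest (primₙ-zero e) = honest e
honest (primₙ-suc {H = H} {k} {ns} d e) with honest d | honest e
... | γ₁ , p₁ | γ₂ , p₂ = γ₁ ∘ γ₂ , λ s g {ls} ls⊑xs →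
  let u , u≡ , eq₁ = p₁ s (γ₂ g) ls⊑xs
      w , w≡ , eq₂ = p₂ s g ls⊑xs
  in w , w≡ , bind-just eq₁
       (trans (cong (λ u → ev H s (k ∷ (ns ∷ʳ u)) ls (γ₂ g)) u≡) eq₂)
honest (primₛ-zero e) = honest e
honest (primₛ-suc d e) with honest d | honest e
... | γ₁ , p₁ | γ₂ , p₂ = γ₁ ∘ γ₂ , λ s g ls⊑xs →
  let u , u⊑ , eq₁ = p₁ s (γ₂ g) ls⊑xs
      w , w⊑ , eq₂ = p₂ s g (∷ʳ⁺ ls⊑xs u⊑)
  in w , w⊑ , bind-just eq₁ eq₂
honest {f = μ G} {ns} {v = k} (μ G>0 G≡0)
  with search-honest G ns (λ j<k → _ , honest (proj₂ (G>0 j<k))) k ≤-refl | honest G≡0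
-- The value `k` is popped first, then the guesses for the tests below `k`, then those for the test
-- at `k`.
... | γ₁ , below | γ₂ , at = pair k ∘ γ₁ ∘ γ₂ , λ s g {ls} ls⊑xs →
  let w , w≡0 , eq = at s g ls⊑xs
      g′ = γ₁ (γ₂ g)
  in k , refl , trans
       (cong₂ (λ k g → search G s ns ls g k >>= λ g → ev G s (k ∷ ns) ls g >>= λ (v , g) →
                if isZero v then just (k , g) else nothing)
         (π₁-pair k g′) (π₂-pair k g′))
       (bind-just (below s (γ₂ g) ls⊑xs)
         (bind-just eq (cong (λ w → if isZero w then just (k , g) else nothing) w≡0)))

honests []       = id , λ _ _ _ → [] , [] , refl
honests (e ∷ es) with honest e | honests es
... | γ₁ , p₁ | γ₂ , p₂ = γ₁ ∘ γ₂ , λ s g ls⊑xs →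
  let w , w-correct , eq₁ = p₁ s (γ₂ g) ls⊑xs
      ws , ws-correct , eq₂ = p₂ s g ls⊑xs
  in w ∷ ws , w-correct ∷ ws-correct , bind-just eq₁ (bind-just eq₂ refl)

-- Wrong guesses are refuted eventually

-- A settled result is a family indexed by the stage, because a sequence is represented by a
-- different table at each stage; `R` speaks about the whole family so that it can express
-- convergence.
Settles : (ℕ → Maybe X) → ((ℕ → X) → Set) → Set
Settles {X} M R =
  Eventually (λ s → M s ≡ nothing) ⊎
  Σ[ W ∈ (ℕ → X) ] R W × Eventually (λ s → M s ≡ just (W s))

refuted : ∀ {M : ℕ → Maybe X} {R} → (∀ s → M s ≡ nothing) → Settles M R
refuted M≡nothing = inj₁ (always M≡nothing)

-- A refutation of the first computation refutes the rest, so the continuation is examined only at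
-- families satisfying `R`, that is, at correct intermediate results.
settles-bind : ∀ {M : ℕ → Maybe X} {K : ℕ → X → Maybe Y} {R R′} → Settles M R →
               (∀ {W} → R W → Settles (λ s → K s (W s)) R′) → Settles (λ s → M s >>= K s) R′
settles-bind {K = K} (inj₁ dead) κ = inj₁ (eventually (λ s eq → cong (_>>= K s) eq) dead)
settles-bind {K = K} (inj₂ (W , r , live)) κ with κ r
... | inj₁ dead = inj₁ (both (λ s eq eq′ → trans (cong (_>>= K s) eq) eq′) live dead)
... | inj₂ (W′ , r′ , live′) =
  inj₂ (W′ , r′ , both (λ s eq eq′ → trans (cong (_>>= K s) eq) eq′) live live′)

settles-cong : ∀ {M N : ℕ → Maybe X} {R} → (∀ s → N s ≡ M s) → Settles M R → Settles N R
settles-cong N≗M (inj₁ dead)           = inj₁ (eventually (λ s eq → trans (N≗M s) eq) dead)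
settles-cong N≗M (inj₂ (W , r , live)) =
  inj₂ (W , r , eventually (λ s eq → trans (N≗M s) eq) live)

Converges : ∀ c → (ℕ → El (val c)) → ⟦ c ⟧ → Set
Converges num V v = ∀ s → V s ≡ v
Converges seq     = _⇝_

-- Matching on this family makes the remaining guesses one number `g`, the same at all stages, as
-- `Settling` requires for the computation that comes next.
data Agrees c (v : ⟦ c ⟧) : (ℕ → El (val c) × ℕ) → Set where
  agrees : ∀ {V} → Converges c V v → ∀ g → Agrees c v (λ s → V s , g)

data AgreesAll c (vs : Vec ⟦ c ⟧ m) : (ℕ → Vec (El (val c)) m × ℕ) → Set where
  agrees : ∀ {Vs} → Pointwise (Converges c) Vs vs → ∀ g → AgreesAll c vs (λ s → stage Vs s , g)

data Constant (X : Set) : (ℕ → X) → Set where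
  constant : ∀ x → Constant X (λ _ → x)

Settling : PR p q c → Vec ℕ p → Vec 𝒩 q → ⟦ c ⟧ → Set
Settling {c = c} f ns xs v = ∀ {Ls} → Pointwise _⇝_ Ls xs → ∀ g →
  Settles (λ s → ev f s ns (stage Ls s) g) (Agrees c v)

just-settles : ∀ {M : ℕ → X} {R} → R M → Settles (λ s → just (M s)) R
just-settles r = inj₂ (_ , r , always λ _ → refl)

stage-≡ : ∀ {Vs : Vec (ℕ → ℕ) n} {ns} → Pointwise (Converges num) Vs ns → ∀ s → stage Vs s ≡ ns
stage-≡ []         s = refl
stage-≡ (v≡ ∷ vs≡) s = cong₂ _∷_ (v≡ s) (stage-≡ vs≡ s)

answer-zero : ∀ {L x} → L ⇝ x → (∀ i → x i ≡ 0) → ∀ a →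
              Settles (λ s → answer (L s) a) (λ W → ∀ s → W s ≡ 1)
answer-zero {L} (L⊑x , _) x≡0 zero = inj₂ ((λ _ → 1) , (λ _ → refl) , always λ s →
  cong (λ b → if b then nothing else just 1) (hasNonzero-false (L s) x≡0 (L⊑x s)))
answer-zero (_ , L→x) x≡0 (suc i) = inj₁ (eventually
  (λ s eq → cong (λ v → if vanishes v then nothing else just 0) (trans eq (cong just (x≡0 i))))
  (L→x i))

answer-nonzero : ∀ {L x} → L ⇝ x → ∃[ i ] x i ≢ 0 → ∀ a →
                 Settles (λ s → answer (L s) a) (λ W → ∀ s → W s ≡ 0)
answer-nonzero {L} {x} (_ , L→x) (i , xi≢0) zero with x i in xi
... | zero  = contradiction refl xi≢0
... | suc v = inj₁ (eventually
  (λ s eq → cong (λ b → if b then nothing else just 1)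
    (hasNonzero-true (L s) i (trans eq (cong just xi))))
  (L→x i))
answer-nonzero {L} {x} (L⊑x , L→x) _ (suc i) with x i in xi
... | zero  = inj₁ (eventually
  (λ s eq → cong (λ v → if vanishes v then nothing else just 0) (trans eq (cong just xi)))
  (L→x i))
... | suc v = inj₂ ((λ _ → 0) , (λ _ → refl) , always λ s →
  cong (λ b → if b then nothing else just 0)
    (vanishes-false (L s) i (λ xi≡0 → contradiction (trans (sym xi) xi≡0) λ ()) (L⊑x s)))

settling  : ∀ {f : PR p q c} {ns xs v} → Eval f ns xs v → Settling f ns xs v
settlings : ∀ {fs : Vec (PR p q c) m} {ns xs vs} → Pointwise (λ f → Eval f ns xs) fs vs →
            ∀ {Ls} → Pointwise _⇝_ Ls xs → ∀ g →
            Settles (λ s → evs fs s ns (stage Ls s) g) (AgreesAll c vs)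

module _ (G : PR (suc p) q num) (ns : Vec ℕ p) {xs : Vec 𝒩 q} {Ls : Vec (ℕ → Approx) q}
         (Ls⇝xs : Pointwise _⇝_ Ls xs) where

  search-settles : (∀ {j} → j < k → ∃[ v ] Settling G (j ∷ ns) xs (suc v)) → ∀ g j → j ≤ k →
                   Settles (λ s → search G s ns (stage Ls s) g j) (Constant ℕ)
  search-settles G>0 g zero    _   = just-settles (constant g)
  search-settles G>0 g (suc j) j<k = settles-bind (search-settles G>0 g j (<⇒≤ j<k))
    λ { (constant g′) → settles-bind (proj₂ (G>0 j<k) Ls⇝xs g′)
      λ { (agrees V≡ g″) → settles-cong
            (λ s → cong (λ v → if isZero v then nothing else just g″) (V≡ s))
            (just-settles (constant g″)) } }

  search-refuted : ∀ {R} g {j} → j ≤′ k →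
                   Eventually (λ s → search G s ns (stage Ls s) g j ≡ nothing) →
                   Settles (λ s → search G s ns (stage Ls s) g k) R
  search-refuted g ≤′-refl       dead = inj₁ dead
  search-refuted g (≤′-step j≤k) dead =
    -- With an empty `R`, `Settles` says that the search is eventually refuted. A longer search
    -- begins with the shorter one and inherits its refutation.
    settles-bind {R = λ _ → ⊥} (search-refuted g j≤k dead) λ ()

  -- A guess `a` below `k` fails at the final test, where `G` is nonzero; a guess above `k` fails
  -- when the search meets the zero at `k`. So no value of `G` beyond `k`, where it may be
  -- undefined, has to be known.
  μ-settles : (∀ {j} → j < k → ∃[ v ] Settling G (j ∷ ns) xs (suc v)) → Settling G (k ∷ ns) xs 0 →
              ∀ g a → Settles
                (λ s → search G s ns (stage Ls s) g a >>= λ g → ev G s (a ∷ ns) (stage Ls s) g >>=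
                  λ (v , g) → if isZero v then just (a , g) else nothing)
                (Agrees num k)
  μ-settles {k} G>0 G≡0 g a with <-cmp a k
  ... | tri< a<k _ _ = settles-bind (search-settles G>0 g a (<⇒≤ a<k))
    λ { (constant g′) → settles-bind (proj₂ (G>0 a<k) Ls⇝xs g′)
      λ { (agrees V≡ g″) → refuted λ s →
            cong (λ v → if isZero v then just (a , g″) else nothing) (V≡ s) } }
  ... | tri≈ _ refl _ = settles-bind (search-settles G>0 g a ≤-refl)
    λ { (constant g′) → settles-bind (G≡0 Ls⇝xs g′)
      λ { (agrees V≡ g″) → settles-cong
            (λ s → cong (λ v → if isZero v then just (a , g″) else nothing) (V≡ s))
            (just-settles (agrees (λ _ → refl) g″)) } }
  ... | tri> _ _ k<a = settles-bind {R = λ _ → ⊥} (search-past (≤⇒≤′ k<a)) λ ()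
    where
    stops : Settles (λ s → search G s ns (stage Ls s) g (suc k)) (λ _ → ⊥)
    stops = settles-bind (search-settles G>0 g k ≤-refl)
      λ { (constant g′) → settles-bind (G≡0 Ls⇝xs g′)
        λ { (agrees V≡ g″) → refuted λ s →
              cong (λ v → if isZero v then nothing else just g″) (V≡ s) } }

    search-past : suc k ≤′ a → Settles (λ s → search G s ns (stage Ls s) g a) (λ _ → ⊥)
    search-past k<a with stops
    ... | inj₁ dead = search-refuted g k<a dead

settling zero      Ls⇝xs g = just-settles (agrees (λ _ → refl) g)
settling succ      Ls⇝xs g = just-settles (agrees (λ _ → refl) g)
settling (projₙ i) Ls⇝xs g = just-settles (agrees (λ _ → refl) g)
settling (projₛ j) {Ls} Ls⇝xs g = settles-cong
  (λ s → cong (λ l → just (l , g)) (lookup-map j (_$ s) Ls))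
  (just-settles (agrees (Pointwise.lookup Ls⇝xs j) g))
settling (Ψ {e = e} Φy) Ls⇝xs g = just-settles (agrees (tabulate-complete Ls⇝xs {e} Φy) g)
settling (χ-zero x≡0) (L⇝x ∷ []) g = settles-bind (answer-zero L⇝x x≡0 (π₁ g))
  λ W≡ → just-settles (agrees W≡ (π₂ g))
settling (χ-else x≢0) (L⇝x ∷ []) g = settles-bind (answer-nonzero L⇝x x≢0 (π₁ g))
  λ W≡ → just-settles (agrees W≡ (π₂ g))
settling (comp {f = f} gs hs e) Ls⇝xs g = settles-bind (settlings gs Ls⇝xs g)
  λ { (agrees Ns≡ g′) → settles-bind (settlings hs Ls⇝xs g′)
    λ { (agrees {Vs} Vs⇝ g″) → settles-cong
          (λ s → cong (λ ns → ev f s ns (stage Vs s) g″) (stage-≡ Ns≡ s))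
          (settling e Vs⇝ g″) } }
settling (primₙ-zero e) = settling e
settling (primₙ-suc {H = H} {k} {ns} d e) {Ls} Ls⇝xs g = settles-bind (settling d Ls⇝xs g)
  λ { (agrees V≡ g′) → settles-cong
        (λ s → cong (λ u → ev H s (k ∷ (ns ∷ʳ u)) (stage Ls s) g′) (V≡ s))
        (settling e Ls⇝xs g′) }
settling (primₛ-zero e) = settling e
settling (primₛ-suc {H = H} {k} {ns} d e) {Ls} Ls⇝xs g = settles-bind (settling d Ls⇝xs g)
  λ { (agrees {V} V⇝ g′) → settles-cong
        (λ s → cong (λ ls → ev H s (k ∷ ns) ls g′) (sym (map-∷ʳ (_$ s) V Ls)))
        (settling e (∷ʳ⁺ Ls⇝xs V⇝) g′) }
settling (μ {G = G} {ns} G>0 G≡0) Ls⇝xs g =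
  μ-settles G ns Ls⇝xs (λ j<k → _ , settling (proj₂ (G>0 j<k))) (settling G≡0) (π₂ g) (π₁ g)

settlings []       Ls⇝xs g = just-settles (agrees [] g)
settlings (e ∷ es) Ls⇝xs g = settles-bind (settling e Ls⇝xs g)
  λ { (agrees V⇝ g′) → settles-bind (settlings es Ls⇝xs g′)
    λ { (agrees Vs⇝ g″) → just-settles (agrees (V⇝ ∷ Vs⇝) g″) } }

-- Cylinders

recursiveDoubleSequence : ∀ {σ} → Computable (nat ⊗ nat) (list nat) (uncurry σ) →
                          RecursiveDoubleSequence σ
recursiveDoubleSequence {σ} (computable h r t) =
  Recursive.program program , λ i j →
    subst (EvalRec _ _) (trans (t (i , j)) (code-encode (σ i j)))
      (Recursive.correct program (i ∷ j ∷ []))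
  where
  program : Recursive {2} λ ns → h (pair (lookup ns 0F) (lookup ns 1F))
  program = apᴿ₁ r (apᴿ₂ pairᴿ (argᴿ 0F) (argᴿ 1F))

≺-⊑ : ∀ σ {x} → σ ≺ x → List.map just σ ⊑ x
≺-⊑ (a ∷ σ) σ≺x zero    refl = sym (σ≺x zero)
≺-⊑ (a ∷ σ) σ≺x (suc i) eq   = ≺-⊑ σ (σ≺x ∘ suc) i eq

applyUpTo-≺ : ∀ x s → applyUpTo x s ≺ x
applyUpTo-≺ x s k = lookup-applyUpTo x s k

initials-⇝ : ∀ x → (λ s → List.map just (applyUpTo x s)) ⇝ x
initials-⇝ x = (λ s → ≺-⊑ (applyUpTo x s) (applyUpTo-≺ x s)) , λ i → suc i , λ s i<s →
  trans (cong (λ l → look l i) (map-applyUpTo x just s)) (look-applyUpTo (just ∘ x) i<s)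

-- Rejection of guesses by initial segments.

disagrees : ℕ → Maybe (ℕ × ℕ) → Bool
disagrees b = maybe (λ (v , _) → if v ≡ᵇ b then false else true) true

-- The length of `σ` doubles as the stage, so longer segments also bring more machine steps and
-- longer tables. A refuted list of guesses counts as rejected.
rejects : PR 0 1 num → ℕ → ℕ → List ℕ → Bool
rejects f b g σ = disagrees b (ev f (length σ) [] (List.map just σ ∷ []) g)

rejectsᶜ : ∀ f b {G L} → Computable Γ nat G → Computable Γ (list nat) L →
           Computable Γ bool (λ γ → rejects f b (G γ) (L γ))
rejectsᶜ f b g l = maybeᶜ (evᶜ f lengthᶜ vnilᶜ (map-justᶜ ∷ᵛ vnilᶜ) g)
  (ifᶜ (≡ᵇᶜ (fstᶜ (sndᶜ varᶜ)) (constᶜ b)) (constᶜ false) (constᶜ true))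
  (constᶜ true)
  where
  lengthᶜ = listrecᶜ (λ _ → length) (constᶜ 0) (sucᶜ (sndᶜ (sndᶜ (sndᶜ varᶜ))))
    (λ _ → refl) (λ _ _ _ → refl) l

  map-justᶜ = listrecᶜ (λ _ → List.map just) nilᶜ
    (justᶜ (fstᶜ (sndᶜ varᶜ)) ∷ᶜ sndᶜ (sndᶜ (sndᶜ varᶜ))) (λ _ → refl) (λ _ _ _ → refl) l

≡ᵇ-refl : ∀ n → (n ≡ᵇ n) ≡ true
≡ᵇ-refl zero    = refl
≡ᵇ-refl (suc n) = ≡ᵇ-refl n

≢⇒≡ᵇ : ∀ {m n} → m ≢ n → (m ≡ᵇ n) ≡ false
≢⇒≡ᵇ {m} {n} m≢n with m ≡ᵇ n in eq
... | true  = contradiction (≡ᵇ⇒≡ m n (subst T (sym eq) _)) m≢n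
... | false = refl

never-rejected : ∀ {f x b} → Eval f [] (x ∷ []) b →
                 ∃[ g ] ∀ σ → σ ≺ x → rejects f b g σ ≡ false
never-rejected {f} {b = b} e with honest e
-- The guesses left over at the end may be anything; 0 is put there.
... | γ , p = γ 0 , λ σ σ≺x →
  let w , w≡b , eq = p (length σ) 0 (≺-⊑ σ σ≺x ∷ []) in
  trans (cong (disagrees b) eq)
    (cong (if_then false else true) (trans (cong (_≡ᵇ b) w≡b) (≡ᵇ-refl b)))

eventually-rejected : ∀ {f x b b′} → Eval f [] (x ∷ []) b′ → b′ ≢ b → ∀ g →
                      ∃[ s ] rejects f b g (applyUpTo x s) ≡ true
eventually-rejected {f} {x} {b} e b′≢b g = rejected (settling e (initials-⇝ x ∷ []) g)
  where
  at : ∀ s → rejects f b g (applyUpTo x s) ≡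
             disagrees b (ev f s [] (List.map just (applyUpTo x s) ∷ []) g)
  at s = cong (λ n → disagrees b (ev f n [] (List.map just (applyUpTo x s) ∷ []) g))
    (length-applyUpTo x s)

  rejected : Settles _ (Agrees num _) → _
  rejected (inj₁ (s , dead)) = s , trans (at s) (cong (disagrees b) (dead s ≤-refl))
  rejected (inj₂ (_ , agrees V≡ _ , s , live)) = s , trans (at s)
    (trans (cong (disagrees b) (live s ≤-refl))
      (cong (if_then false else true) (trans (cong (_≡ᵇ b) (V≡ s)) (≢⇒≡ᵇ b′≢b))))

-- Phrased for a decision between two distinct values, so that it covers both the set and its
-- complement, with 0 and 1 exchanged.
decided⇒Π⁰₂ : ∀ {B : Pred 𝒩 ℓ} {f b b′} → b′ ≢ b →
              (∀ x → (x ∈ B × Eval f [] (x ∷ []) b′) ⊎ (x ∉ B × Eval f [] (x ∷ []) b)) → Π⁰₂ B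
decided⇒Π⁰₂ {B = B} {f} {b} b′≢b decide =
  σ , recursiveDoubleSequence σᶜ , (λ {x} → covered x) , (λ {x} → captured x)
  where
  -- No σ i j is an empty cylinder, so a filler is needed where nothing is
  -- rejected; as π₁ i varies, the fillers have no point in common.
  σ : ℕ → ℕ → List ℕ
  σ i j = if rejects f b (π₂ i) (decode j) then decode j else π₁ i ∷ []

  σᶜ : Computable (nat ⊗ nat) (list nat) (uncurry σ)
  σᶜ = ifᶜ (rejectsᶜ f b (π₂ᶜ (fstᶜ varᶜ)) (decodeᶜ (sndᶜ varᶜ)))
    (decodeᶜ (sndᶜ varᶜ)) (π₁ᶜ (fstᶜ varᶜ) ∷ᶜ nilᶜ)

  covered : ∀ x → x ∈ B → ∀ i → ∃[ j ] σ i j ≺ x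
  covered x x∈B i with decide x
  ... | inj₂ (x∉B , _) = contradiction x∈B x∉B
  ... | inj₁ (_ , e) with eventually-rejected e b′≢b (π₂ i)
  ... | s , rejected = encode τ , subst (_≺ x) (sym σ≡τ) (applyUpTo-≺ x s)
    where
    τ = applyUpTo x s

    σ≡τ : σ i (encode τ) ≡ τ
    σ≡τ = trans (cong (λ τ → if rejects f b (π₂ i) τ then τ else π₁ i ∷ []) (decode-encode τ))
      (cong (if_then τ else π₁ i ∷ []) rejected)

  captured : ∀ x → (∀ i → ∃[ j ] σ i j ≺ x) → x ∈ B
  captured x x∈σ with decide x
  ... | inj₁ (x∈B , _) = x∈B
  ... | inj₂ (_ , e) with never-rejected e
  ... | g , accepted = ⊥-elim (escapes (x∈σ i))
    where
    -- The first component excludes the filler, which would make `x 0` equal to its successor; the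
    -- second is the list of guesses that no initial segment of `x` rejects.
    i = pair (suc (x 0)) g

    escapes : ¬ (∃[ j ] σ i j ≺ x)
    escapes (j , σ≺x) with rejects f b (π₂ i) (decode j) in eq
    ... | false = contradiction (trans (sym (π₁-pair (suc (x 0)) g)) (σ≺x zero)) 1+n≢n
    ... | true  with () ← trans (sym eq)
      (trans (cong (λ g → rejects f b g (decode j)) (π₂-pair (suc (x 0)) g))
        (accepted (decode j) σ≺x))

theorem2p24 : ∀ {ℓ : Level} (A : Pred 𝒩 ℓ) → RecursiveOver𝒩 A → Δ⁰₂ A
theorem2p24 A (f , decide) = decided⇒Π⁰₂ (λ ()) complement , decided⇒Π⁰₂ (λ ()) decide
  where
  complement : ∀ x → (x ∈ ∁ A × Eval f [] (x ∷ []) 0) ⊎ (x ∉ ∁ A × Eval f [] (x ∷ []) 1)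
  complement x with decide x
  ... | inj₁ (x∈A , e) = inj₂ ((λ x∉A → x∉A x∈A) , e)
  ... | inj₂ (x∉A , e) = inj₁ (x∉A , e)
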